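{- If $D$ is a model of $\mathrm{ECBDA}$ or of $\mathrm{ECDA}$, then for an arbitrary set $A\subseteq D$ the definable closure $\operatorname{dcl}(A)$ and the algebraic closure $\operatorname{acl}(A)$ of $A$ in $D$ are both equal to the Boole-De Morgan subalgebra of $D$ generated by $A$.
   Context: A De Morgan algebra is a bounded distributive lattice $(D;+,\cdot,0,1)$ ($+$ join, $\cdot$ meet) with a unary operation $\bar{\ }$ satisfying $\bar{\bar x}=x$ and $\overline{x+y}=\bar x\cdot\bar y$. It is complemented if $\forall x\exists y\,(xy=0\wedge x+y=1)$. A Boole-De Morgan algebra is an algebra $(A;+,\cdot,',\bar{\ },0,1)$ such that $(A;+,\cdot,',0,1)$ is a Boolean algebra (with complement $'$) and $(A;+,\cdot,\bar{\ },0,1)$ is a De Morgan algebra. A complemented De Morgan algebra (in particular a model of $\mathrm{ECDA}$) is regarded as a Boole-De Morgan algebra by letting $x'$ be the unique lattice complement of $x$. Put $x^*:=(\bar x)'=\overline{(x')}$ (the two agree in every Boole-De Morgan algebra). For a structure $M$ and $A\subseteq M$, $\operatorname{acl}(A)$ (respectively $\operatorname{dcl}(A)$) is the union of all finite subsets (respectively singletons) of $M$ definable with parameters from $A$. Consistency: for $\sigma\in S_n$, a triple $(I_1,I_2,I_3)$ of subsets of $\{1,\dots,n\}$ is $\sigma$-consistent if $\sigma(I_2)=I_2$, $\sigma(I_3)=I_3$, and $(I_1\cap I_2\cap I_3)\cap\sigma(I_1\cap I_2\cap I_3)=\emptyset$. Theory $\mathrm{ECBDA}$: for $y=(y_1,\dots,y_n)$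 and $I_1,I_2,I_3\subseteq\{1,\dots,n\}$, let $\varphi^n_{(I_1,I_2,I_3)}(y,x)$ be the conjunction of $$\bigwedge_{i\in I_1}y_i\cdot x\bar x=0\wedge\bigwedge_{i\notin I_1}y_i\cdot x\bar x\neq0,\quad \bigwedge_{i\in I_2}y_i\cdot xx^*=0\wedge\bigwedge_{i\notin I_2}y_i\cdot xx^*\neq0,\quad \bigwedge_{i\in I_3}y_i\cdot x'\bar x=0\wedge\bigwedge_{i\notin I_3}y_i\cdot x'\bar x\neq0.$$ $\mathrm{ECBDA}$ consists of the axioms of Boole-De Morgan algebras and the sentences $$\forall y_1,\dots,y_n\Big(\bigwedge_iy_i\neq0\wedge\sum_{i=1}^ny_i=1\wedge\bigwedge_{i\neq j}y_i\cdot y_j=0\wedge\bigwedge_iy_i^*=y_{\sigma(i)}\rightarrow\exists x\,\varphi^n_{(I_1,I_2,I_3)}(y,x)\Big)$$ for each integer $n\ge1$, each $\sigma\in S_n$ with $\sigma^2$ the identity, and each $\sigma$-consistent triple $(I_1,I_2,I_3)$ of subsets of $\{1,\dots,n\}$. Theory $\mathrm{ECDA}$ (in the language $\{+,\cdot,\bar{\ },0,1\}$): for $I\subseteq\{1,\dots,n\}$ put $$\tilde\psi^n_I(y,x):=\bigwedge_{i\in I}y_i\cdot x\bar x=0\wedge\bigwedge_{i\notin I}y_i\cdot x\bar x\neq0,$$ $$\tilde\xi^n_I(y,x):=\exists z\Big(\bar x+z=1\wedge\bar xz=0\wedge\bigwedge_{i\in I}y_i\cdot xz=0\wedge\bigwedge_{i\notin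 I}y_i\cdot xz\neq0\Big),$$ $$\tilde\chi^n_I(y,x):=\exists z\Big(x+z=1\wedge xz=0\wedge\bigwedge_{i\in I}y_i\cdot z\bar x=0\wedge\bigwedge_{i\notin I}y_i\cdot z\bar x\neq0\Big),$$ and $\tilde\varphi^n_{(I_1,I_2,I_3)}:=\tilde\psi^n_{I_1}\wedge\tilde\xi^n_{I_2}\wedge\tilde\chi^n_{I_3}$. $\mathrm{ECDA}$ consists of the axioms of complemented De Morgan algebras and the sentences $$\forall y_1,\dots,y_n\Big(\bigwedge_iy_i\neq0\wedge\sum_{i=1}^ny_i=1\wedge\bigwedge_{i\neq j}y_iy_j=0\wedge\bigwedge_i(\bar y_i+y_{\sigma(i)}=1\wedge\bar y_iy_{\sigma(i)}=0)\rightarrow\exists x\,\tilde\varphi^n_{(I_1,I_2,I_3)}(y,x)\Big)$$ for the same range of $n$, $\sigma$ and $(I_1,I_2,I_3)$. -}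

module Defs where

open import Level using (Level; Lift; _⊔_; suc)
open import Algebra.Core using (Op₁; Op₂)
open import Algebra.Lattice.Structures using (IsDistributiveLattice; IsBooleanAlgebra)
open import Algebra.Lattice.Structures.Biased using (isBooleanAlgebraʳ)
import Algebra.Definitions
open import Data.Empty.Polymorphic using () renaming (⊥ to Falsum)
open import Data.Fin.Base using (Fin; zero) renaming (suc to fsuc)
open import Data.Fin.Permutation using (Permutation′; _⟨$⟩ʳ_; _⟨$⟩ˡ_)
open import Data.Fin.Subset using (Subset; _∈_; _∉_; _∩_) renaming (⊥ to ∅)
open import Data.List.Base using (List)
import Data.List.Membership.Setoid as SetoidMembership
open import Data.Nat.Base using (ℕ; _≤_) renaming (suc to nsuc)
open import Data.Product.Base using (Σ; ∃; ∃-syntax; _×_; _,_; proj₁; proj₂)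
open import Data.Sum.Base using (_⊎_)
import Data.Vec.Base as Vec
open import Data.Vec.Functional using (Vector; _∷_; foldr)
open import Function.Bundles using (_⇔_)
open import Relation.Binary.Bundles using (Setoid)
open import Relation.Binary.Core using (Rel)
open import Relation.Binary.PropositionalEquality using (_≡_; _≢_)
open import Relation.Binary.Structures using (IsEquivalence)
import Relation.Binary.Reasoning.Setoid as SetoidReasoning
open import Relation.Nullary.Negation.Core using () renaming (¬_ to Not)
open import Relation.Unary using (Pred)

-- The signatures below are purely functional: equality is the
-- only relation symbol; it is interpreted by the setoid equality.

record Signature : Set₁ where
  field
    Op    : Set
    arity : Op → ℕ

module _ (L : Signature) where
  open Signature L

  infix  4 _≗_
  infixr 3 _and_
  infixr 2 _or_
  infixr 1 _imp_

  data Term (n : ℕ) : Set where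
    var : Fin n → Term n
    app : (f : Op) → (Fin (arity f) → Term n) → Term n

  -- Formula n : formulas whose free variables are among n de Bruijn
  -- variables; a quantifier binds variable zero.
  data Formula (n : ℕ) : Set where
    _≗_     : Term n → Term n → Formula n
    falsum  : Formula n
    _and_   : Formula n → Formula n → Formula n
    _or_    : Formula n → Formula n → Formula n
    _imp_   : Formula n → Formula n → Formula n
    all     : Formula (nsuc n) → Formula n
    ex      : Formula (nsuc n) → Formula n

record Structure (L : Signature) (c ℓ : Level) : Set (suc (c ⊔ ℓ)) where
  open Signature L
  infix 4 _≈_
  field
    Carrier       : Set c
    _≈_           : Rel Carrier ℓ
    isEquivalence : IsEquivalence _≈_
    interp        : (f : Op) → Vector Carrier (arity f) → Carrier
    interp-cong   : (f : Op) {u v : Vector Carrier (arity f)} →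
                    (∀ i → u i ≈ v i) → interp f u ≈ interp f v

  setoid : Setoid c ℓ
  setoid = record { isEquivalence = isEquivalence }

module _ {L : Signature} {c ℓ : Level} (M : Structure L c ℓ) where
  open Structure M
  open SetoidMembership setoid using () renaming (_∈_ to _∈ₗ_)

  eval : {n : ℕ} → Vector Carrier n → Term L n → Carrier
  eval ρ (var i)    = ρ i
  eval ρ (app f ts) = interp f (λ i → eval ρ (ts i))

  Sat : {n : ℕ} → Vector Carrier n → Formula L n → Set (c ⊔ ℓ)
  Sat ρ (s ≗ t)   = Lift c (eval ρ s ≈ eval ρ t)
  Sat ρ falsum    = Falsum
  Sat ρ (φ and ψ) = Sat ρ φ × Sat ρ ψ
  Sat ρ (φ or ψ)  = Sat ρ φ ⊎ Sat ρ ψ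
  Sat ρ (φ imp ψ) = Sat ρ φ → Sat ρ ψ
  Sat ρ (all φ)   = (x : Carrier) → Sat (x ∷ ρ) φ
  Sat ρ (ex φ)    = ∃ λ (x : Carrier) → Sat (x ∷ ρ) φ

  -- A subset of M definable with parameters from A, presented by a
  -- defining formula; variable zero is the free variable and the others
  -- are filled by the parameters.
  record DefinableSet {p : Level} (A : Pred Carrier p) : Set (c ⊔ p) where
    field
      {arityₚ}   : ℕ
      formula    : Formula L (nsuc arityₚ)
      params     : Vector Carrier arityₚ
      params∈A   : ∀ i → A (params i)

    extension : Pred Carrier (c ⊔ ℓ)
    extension x = Sat (x ∷ params) formula

  FiniteSubset : {q : Level} → Pred Carrier q → Set (c ⊔ ℓ ⊔ q)
  FiniteSubset P = ∃ λ (xs : List Carrier) → ∀ x → P x ⇔ (x ∈ₗ xs)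

  SingletonSubset : {q : Level} → Pred Carrier q → Set (c ⊔ ℓ ⊔ q)
  SingletonSubset P = ∃ λ (a : Carrier) → ∀ x → P x ⇔ (x ≈ a)

  acl : {p : Level} → Pred Carrier p → Pred Carrier (c ⊔ ℓ ⊔ p)
  acl A x = Σ (DefinableSet A) λ S →
    FiniteSubset (DefinableSet.extension S) × DefinableSet.extension S x

  dcl : {p : Level} → Pred Carrier p → Pred Carrier (c ⊔ ℓ ⊔ p)
  dcl A x = Σ (DefinableSet A) λ S →
    SingletonSubset (DefinableSet.extension S) × DefinableSet.extension S x

-- In the algebras below, _∨_ is +, _∧_ is ·, ∼_ is the
-- bar and ¬_ is the Boolean complement ′.

record IsDeMorganAlgebra {c ℓ : Level} {Carrier : Set c} (_≈_ : Rel Carrier ℓ)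
         (_∨_ _∧_ : Op₂ Carrier) (∼_ : Op₁ Carrier) (⊤ ⊥ : Carrier) :
         Set (c ⊔ ℓ) where
  open Algebra.Definitions _≈_
  field
    isDistributiveLattice : IsDistributiveLattice _≈_ _∨_ _∧_
    ∨-identity            : Identity ⊥ _∨_
    ∧-identity            : Identity ⊤ _∧_
    ∼-cong                : Congruent₁ ∼_
    ∼-involutive          : Involutive ∼_
    ∼-deMorgan            : ∀ x y → (∼ (x ∨ y)) ≈ ((∼ x) ∧ (∼ y))

  open IsDistributiveLattice isDistributiveLattice public

record ComplementedDeMorganAlgebra (c ℓ : Level) : Set (suc (c ⊔ ℓ)) where
  infix  8 ∼_
  infixr 7 _∧_
  infixr 6 _∨_
  infix  4 _≈_
  field
    Carrier           : Set c
    _≈_               : Rel Carrier ℓ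
    _∨_               : Op₂ Carrier
    _∧_               : Op₂ Carrier
    ∼_                : Op₁ Carrier
    ⊤                 : Carrier
    ⊥                 : Carrier
    isDeMorganAlgebra : IsDeMorganAlgebra _≈_ _∨_ _∧_ ∼_ ⊤ ⊥
    complemented      : ∀ x → ∃[ y ] (x ∧ y ≈ ⊥ × x ∨ y ≈ ⊤)

  open IsDeMorganAlgebra isDeMorganAlgebra public

  setoid : Setoid c ℓ
  setoid = record { isEquivalence = isEquivalence }

record BooleDeMorganAlgebra (c ℓ : Level) : Set (suc (c ⊔ ℓ)) where
  infix  8 ¬_ ∼_ _*
  infixr 7 _∧_
  infixr 6 _∨_
  infix  4 _≈_
  field
    Carrier           : Set c
    _≈_               : Rel Carrier ℓ
    _∨_               : Op₂ Carrier
    _∧_               : Op₂ Carrier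
    ¬_                : Op₁ Carrier
    ∼_                : Op₁ Carrier
    ⊤                 : Carrier
    ⊥                 : Carrier
    isBooleanAlgebra  : IsBooleanAlgebra _≈_ _∨_ _∧_ ¬_ ⊤ ⊥
    isDeMorganAlgebra : IsDeMorganAlgebra _≈_ _∨_ _∧_ ∼_ ⊤ ⊥

  open IsDeMorganAlgebra isDeMorganAlgebra public
  open IsBooleanAlgebra isBooleanAlgebra public using (¬-cong; ∨-complement; ∧-complement)

  _* : Op₁ Carrier
  x * = ¬ (∼ x)

-- Complements in a bounded distributive lattice are unique, so the choice
-- of complement made by `complemented` is immaterial up to _≈_.
module _ {c ℓ : Level} (D : ComplementedDeMorganAlgebra c ℓ) where
  open ComplementedDeMorganAlgebra D

  complement-unique : ∀ {x y z} → x ∧ y ≈ ⊥ → x ∨ y ≈ ⊤ →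
                      x ∧ z ≈ ⊥ → x ∨ z ≈ ⊤ → y ≈ z
  complement-unique {x} {y} {z} xy₀ xy₁ xz₀ xz₁ = begin
    y                  ≈⟨ proj₂ ∧-identity y ⟨
    y ∧ ⊤              ≈⟨ ∧-cong refl xz₁ ⟨
    y ∧ (x ∨ z)        ≈⟨ ∧-distribˡ-∨ y x z ⟩
    y ∧ x ∨ y ∧ z      ≈⟨ ∨-cong (trans (∧-comm y x) (trans xy₀ (sym xz₀))) refl ⟩
    x ∧ z ∨ y ∧ z      ≈⟨ ∧-distribʳ-∨ z x y ⟨
    (x ∨ y) ∧ z        ≈⟨ ∧-cong xy₁ refl ⟩
    ⊤ ∧ z              ≈⟨ proj₁ ∧-identity z ⟩
    z                  ∎
    where open SetoidReasoning setoid

  asBooleDeMorgan : BooleDeMorganAlgebra c ℓ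
  asBooleDeMorgan = record
    { _≈_               = _≈_
    ; _∨_               = _∨_
    ; _∧_               = _∧_
    ; ¬_                = λ x → proj₁ (complemented x)
    ; ∼_                = ∼_
    ; ⊤                 = ⊤
    ; ⊥                 = ⊥
    ; isBooleanAlgebra  = isBooleanAlgebraʳ record
      { isDistributiveLattice = isDistributiveLattice
      ; ∨-complementʳ         = λ x → proj₂ (proj₂ (complemented x))
      ; ∧-complementʳ         = λ x → proj₁ (proj₂ (complemented x))
      ; ¬-cong                = λ {x} {y} x≈y →
          let (_ , xx₀ , xx₁) = complemented x
              (_ , yy₀ , yy₁) = complemented y
          in complement-unique xx₀ xx₁
               (trans (∧-cong x≈y refl) yy₀) (trans (∨-cong x≈y refl) yy₁)
      }
    ; isDeMorganAlgebra = isDeMorganAlgebra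
    }

module _ {c ℓ : Level} (D : BooleDeMorganAlgebra c ℓ) where
  open BooleDeMorganAlgebra D

  -- The subalgebra generated by A; `resp` makes it a subset of the setoid.
  data Generated {p : Level} (A : Pred Carrier p) : Pred Carrier (c ⊔ ℓ ⊔ p) where
    gen  : ∀ {x} → A x → Generated A x
    join : ∀ {x y} → Generated A x → Generated A y → Generated A (x ∨ y)
    meet : ∀ {x y} → Generated A x → Generated A y → Generated A (x ∧ y)
    comp : ∀ {x} → Generated A x → Generated A (¬ x)
    bar  : ∀ {x} → Generated A x → Generated A (∼ x)
    top  : Generated A ⊤
    bot  : Generated A ⊥
    resp : ∀ {x y} → x ≈ y → Generated A x → Generated A y

data DMOp : Set where
  join meet bar top bot : DMOp

DMSignature : Signature
DMSignature = record
  { Op    = DMOp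
  ; arity = λ { join → 2 ; meet → 2 ; bar → 1 ; top → 0 ; bot → 0 }
  }

data BDMOp : Set where
  join meet comp bar top bot : BDMOp

BDMSignature : Signature
BDMSignature = record
  { Op    = BDMOp
  ; arity = λ { join → 2 ; meet → 2 ; comp → 1 ; bar → 1 ; top → 0 ; bot → 0 }
  }

DMStructure : {c ℓ : Level} → ComplementedDeMorganAlgebra c ℓ → Structure DMSignature c ℓ
DMStructure D = record
  { Carrier       = Carrier
  ; _≈_           = _≈_
  ; isEquivalence = isEquivalence
  ; interp        = λ
      { join v → v zero ∨ v (fsuc zero)
      ; meet v → v zero ∧ v (fsuc zero)
      ; bar  v → ∼ v zero
      ; top  v → ⊤
      ; bot  v → ⊥ }
  ; interp-cong   = λ
      { join u≈v → ∨-cong (u≈v zero) (u≈v (fsuc zero))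
      ; meet u≈v → ∧-cong (u≈v zero) (u≈v (fsuc zero))
      ; bar  u≈v → ∼-cong (u≈v zero)
      ; top  u≈v → refl
      ; bot  u≈v → refl }
  }
  where open ComplementedDeMorganAlgebra D

BDMStructure : {c ℓ : Level} → BooleDeMorganAlgebra c ℓ → Structure BDMSignature c ℓ
BDMStructure D = record
  { Carrier       = Carrier
  ; _≈_           = _≈_
  ; isEquivalence = isEquivalence
  ; interp        = λ
      { join v → v zero ∨ v (fsuc zero)
      ; meet v → v zero ∧ v (fsuc zero)
      ; comp v → ¬ v zero
      ; bar  v → ∼ v zero
      ; top  v → ⊤
      ; bot  v → ⊥ }
  ; interp-cong   = λ
      { join u≈v → ∨-cong (u≈v zero) (u≈v (fsuc zero))
      ; meet u≈v → ∧-cong (u≈v zero) (u≈v (fsuc zero))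
      ; comp u≈v → ¬-cong (u≈v zero)
      ; bar  u≈v → ∼-cong (u≈v zero)
      ; top  u≈v → refl
      ; bot  u≈v → refl }
  }
  where open BooleDeMorganAlgebra D

-- The direct image σ(I): j ∈ σ(I) iff σ⁻¹(j) ∈ I.
image : {n : ℕ} → Permutation′ n → Subset n → Subset n
image σ I = Vec.tabulate (λ j → Vec.lookup I (σ ⟨$⟩ˡ j))

Consistent : {n : ℕ} → Permutation′ n → Subset n → Subset n → Subset n → Set
Consistent σ I₁ I₂ I₃ =
  image σ I₂ ≡ I₂ ×
  image σ I₃ ≡ I₃ ×
  (I₁ ∩ I₂ ∩ I₃) ∩ image σ (I₁ ∩ I₂ ∩ I₃) ≡ ∅

-- Models of ECBDA and of ECDA: the algebra axioms are carried by D, and the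
-- remaining sentences are written out as their satisfaction in D.

module _ {c ℓ : Level} {Carrier : Set c} {_≈_ : Rel Carrier ℓ}
         {_∨_ _∧_ : Op₂ Carrier} {∼_ : Op₁ Carrier} {⊤ ⊥ : Carrier}
         (D : IsDeMorganAlgebra _≈_ _∨_ _∧_ ∼_ ⊤ ⊥) where

  VanishesExactlyOn : {n : ℕ} → Subset n → Vector Carrier n → Carrier → Set ℓ
  VanishesExactlyOn I y t =
    (∀ i → i ∈ I → (y i ∧ t) ≈ ⊥) × (∀ i → i ∉ I → Not ((y i ∧ t) ≈ ⊥))

module _ {c ℓ : Level} (D : BooleDeMorganAlgebra c ℓ) where
  open BooleDeMorganAlgebra D

  φ : {n : ℕ} → Subset n → Subset n → Subset n → Vector Carrier n → Carrier → Set ℓ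
  φ I₁ I₂ I₃ y x =
    VanishesExactlyOn isDeMorganAlgebra I₁ y (x ∧ ∼ x) ×
    VanishesExactlyOn isDeMorganAlgebra I₂ y (x ∧ x *) ×
    VanishesExactlyOn isDeMorganAlgebra I₃ y (¬ x ∧ ∼ x)

  IsModelECBDA : Set (c ⊔ ℓ)
  IsModelECBDA =
    (n : ℕ) → 1 ≤ n →
    (σ : Permutation′ n) → (∀ i → σ ⟨$⟩ʳ (σ ⟨$⟩ʳ i) ≡ i) →
    (I₁ I₂ I₃ : Subset n) → Consistent σ I₁ I₂ I₃ →
    (y : Vector Carrier n) →
    (∀ i → Not (y i ≈ ⊥)) →
    foldr _∨_ ⊥ y ≈ ⊤ →
    (∀ i j → i ≢ j → y i ∧ y j ≈ ⊥) →
    (∀ i → (y i) * ≈ y (σ ⟨$⟩ʳ i)) →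
    ∃[ x ] φ I₁ I₂ I₃ y x

module _ {c ℓ : Level} (D : ComplementedDeMorganAlgebra c ℓ) where
  open ComplementedDeMorganAlgebra D

  ψ̃ : {n : ℕ} → Subset n → Vector Carrier n → Carrier → Set ℓ
  ψ̃ I y x = VanishesExactlyOn isDeMorganAlgebra I y (x ∧ ∼ x)

  ξ̃ : {n : ℕ} → Subset n → Vector Carrier n → Carrier → Set (c ⊔ ℓ)
  ξ̃ I y x = ∃[ z ] (∼ x ∨ z ≈ ⊤ × ∼ x ∧ z ≈ ⊥ × VanishesExactlyOn isDeMorganAlgebra I y (x ∧ z))

  χ̃ : {n : ℕ} → Subset n → Vector Carrier n → Carrier → Set (c ⊔ ℓ)
  χ̃ I y x = ∃[ z ] (x ∨ z ≈ ⊤ × x ∧ z ≈ ⊥ × VanishesExactlyOn isDeMorganAlgebra I y (z ∧ ∼ x))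

  φ̃ : {n : ℕ} → Subset n → Subset n → Subset n → Vector Carrier n → Carrier → Set (c ⊔ ℓ)
  φ̃ I₁ I₂ I₃ y x = ψ̃ I₁ y x × ξ̃ I₂ y x × χ̃ I₃ y x

  IsModelECDA : Set (c ⊔ ℓ)
  IsModelECDA =
    (n : ℕ) → 1 ≤ n →
    (σ : Permutation′ n) → (∀ i → σ ⟨$⟩ʳ (σ ⟨$⟩ʳ i) ≡ i) →
    (I₁ I₂ I₃ : Subset n) → Consistent σ I₁ I₂ I₃ →
    (y : Vector Carrier n) →
    (∀ i → Not (y i ≈ ⊥)) →
    foldr _∨_ ⊥ y ≈ ⊤ →
    (∀ i j → i ≢ j → y i ∧ y j ≈ ⊥) →
    (∀ i → ∼ (y i) ∨ y (σ ⟨$⟩ʳ i) ≈ ⊤ × ∼ (y i) ∧ y (σ ⟨$⟩ʳ i) ≈ ⊥) →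
    ∃[ x ] φ̃ I₁ I₂ I₃ y x

{-# OPTIONS --safe #-}

-- Since * is an automorphism of order 2 of the Boolean algebra, the quantifier-free type of a tuple ρ
-- is the set of vanishing minterms in the ρᵢ and ρᵢ*. The nonzero minterms form a partition of unity
-- permuted by *, and the axioms realize every consistent one-variable type over it. Hence tuples with
-- the same vanishing minterms satisfy the same formulas, by back-and-forth. If x is not generated by
-- the parameters ρ, it splits some minterm of ρ; its type over ρ then has a realization splitting a
-- minterm of xs and ρ, for any finite list xs. Members of xs split no such minterm, so no finite
-- set definable over ρ contains x.

module Submission where

open import Defs
open import Level using (Level; _⊔_; Lift; lift; lower)
open import Algebra.Core using (Op₂)
open import Algebra.Bundles using (CommutativeSemigroup)
open import Algebra.Lattice.Bundles using (BooleanAlgebra)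
import Algebra.Lattice.Properties.BooleanAlgebra as BooleanAlgebraProperties
import Algebra.Properties.CommutativeSemigroup as CommutativeSemigroupProperties
open import Axiom.ExcludedMiddle using (ExcludedMiddle)
open import Data.Bool.Base using (Bool; true; false; not)
import Data.Bool.Properties as Bool
open import Data.Fin.Base using (Fin; zero; suc; _↑ˡ_; _↑ʳ_) renaming (lift to liftFin)
open import Data.Fin.Permutation using (Permutation′; permutation)
open import Data.Fin.Subset using (Subset; _∈_; _∩_)
open import Data.Fin.Subset.Properties using (Empty-unique; x∈p∩q⁻)
open import Data.List.Base as List using (List; []; _∷_; length; filter; cartesianProduct; cartesianProductWith)
import Data.List.Membership.Propositional as ListMembership
open import Data.List.Membership.Propositional.Properties
  using (∈-filter⁺; ∈-filter⁻; ∈-cartesianProductWith⁺; ∈-cartesianProduct⁺; ∈-lookup)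
import Data.List.Membership.Setoid as SetoidMembership
open import Data.List.Relation.Unary.All as All using ()
open import Data.List.Relation.Unary.AllPairs using ([]; _∷_)
open import Data.List.Relation.Unary.Any as Any using (here; there)
open import Data.List.Relation.Unary.Any.Properties using (lookup-index)
open import Data.List.Relation.Unary.Unique.Propositional using (Unique)
import Data.List.Relation.Unary.Unique.Propositional.Properties as Unique
open import Data.Nat.Base using (ℕ; _+_; _≤_; s≤s; z≤n) renaming (suc to nsuc)
open import Data.Nat.Properties using (_≤?_)
open import Data.Product.Base using (∃; _×_; _,_; proj₁; proj₂; swap)
open import Data.Product.Function.NonDependent.Propositional using (_×-⇔_)
import Data.Product.Properties as Product
open import Data.Sum.Base using (_⊎_; inj₁; inj₂)
open import Data.Sum.Function.Propositional using (_⊎-⇔_)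
open import Data.Vec.Base as Vec using (Vec; []; _∷_; drop; lookup)
import Data.Vec.Properties as Vec
open import Data.Vec.Functional using (Vector; _++_; head; tail; foldr) renaming ([] to []ᶠ; _∷_ to _∷ᶠ_)
open import Data.Vec.Functional.Properties using (lookup-++ˡ; lookup-++ʳ)
import Data.Vec.Functional.Relation.Unary.All.Properties as VectorAll
open import Function.Base using (_∘_)
open import Function.Bundles using (_⇔_; mk⇔; Equivalence)
open import Function.Related.TypeIsomorphisms using (→-cong-⇔)
open import Relation.Binary.Core using (Rel)
open import Relation.Binary.Definitions using (Decidable)
open import Relation.Binary.Structures using (IsEquivalence)
open import Relation.Binary.PropositionalEquality as ≡ using (_≡_; _≢_; cong; subst)
import Relation.Binary.Reasoning.Setoid as SetoidReasoning
open import Relation.Nullary.Decidable.Core using (Dec; yes; no; does; map′; ¬?)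
open import Relation.Nullary.Decidable using (does-⇔; dec-true)
open import Relation.Nullary.Negation.Core using (contradiction) renaming (¬_ to Not)
open import Relation.Unary using (Pred; _⊆_; _≐_)

open Equivalence using (to; from)

-- The cell (a , b) stands for ±x · ±x*, with + for true.
Cell : Set
Cell = Bool × Bool

-- The automorphism `*` and the minterms of a tuple.

module Algebra {c ℓ : Level} (D : BooleDeMorganAlgebra c ℓ) where
  open BooleDeMorganAlgebra D public

  complementedDeMorganAlgebra : ComplementedDeMorganAlgebra c ℓ
  complementedDeMorganAlgebra = record
    { isDeMorganAlgebra = isDeMorganAlgebra
    ; complemented      = λ x → ¬ x , proj₂ ∧-complement x , proj₂ ∨-complement x }

  booleanAlgebra : BooleanAlgebra c ℓ
  booleanAlgebra = record { isBooleanAlgebra = isBooleanAlgebra }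

  open BooleanAlgebraProperties booleanAlgebra public
    using ( ∧-zeroˡ; ∧-zeroʳ; ∧-identityˡ; ∧-identityʳ; ∨-identityˡ; ∨-identityʳ
          ; ¬-involutive; deMorgan₂; ¬⊤≈⊥; ¬⊥≈⊤ )

  ∧-commutativeSemigroup : CommutativeSemigroup c ℓ
  ∧-commutativeSemigroup = record
    { _∙_ = _∧_
    ; isCommutativeSemigroup = record
      { isSemigroup = record
        { isMagma = record { isEquivalence = isEquivalence ; ∙-cong = ∧-cong }
        ; assoc = ∧-assoc }
      ; comm = ∧-comm } }

  open CommutativeSemigroupProperties ∧-commutativeSemigroup public
    using (interchange; x∙yz≈y∙xz)

  open SetoidReasoning (BooleanAlgebra.setoid booleanAlgebra) public

  zeroˡ : ∀ {x y} → x ≈ ⊥ → x ∧ y ≈ ⊥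
  zeroˡ {y = y} x≈⊥ = trans (∧-cong x≈⊥ refl) (∧-zeroˡ y)

  zeroʳ : ∀ {x y} → y ≈ ⊥ → x ∧ y ≈ ⊥
  zeroʳ {x = x} y≈⊥ = trans (∧-cong refl y≈⊥) (∧-zeroʳ x)

  ∧-¬-zero⇒≈ : ∀ {x y} → x ∧ ¬ y ≈ ⊥ → y ∧ ¬ x ≈ ⊥ → x ≈ y
  ∧-¬-zero⇒≈ {x} {y} x∧¬y≈⊥ y∧¬x≈⊥ = begin
    x                  ≈⟨ ∧-identityʳ x ⟨
    x ∧ ⊤              ≈⟨ ∧-cong refl (proj₂ ∨-complement y) ⟨
    x ∧ (y ∨ ¬ y)      ≈⟨ ∧-distribˡ-∨ x y (¬ y) ⟩
    x ∧ y ∨ x ∧ ¬ y    ≈⟨ ∨-cong (∧-comm x y) (trans x∧¬y≈⊥ (sym y∧¬x≈⊥)) ⟩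
    y ∧ x ∨ y ∧ ¬ x    ≈⟨ ∧-distribˡ-∨ y x (¬ x) ⟨
    y ∧ (x ∨ ¬ x)      ≈⟨ ∧-cong refl (proj₂ ∨-complement x) ⟩
    y ∧ ⊤              ≈⟨ ∧-identityʳ y ⟩
    y                  ∎

  ∼-deMorgan₁ : ∀ x y → ∼ (x ∧ y) ≈ ∼ x ∨ ∼ y
  ∼-deMorgan₁ x y = begin
    ∼ (x ∧ y)              ≈⟨ ∼-cong (∧-cong (∼-involutive x) (∼-involutive y)) ⟨
    ∼ (∼ ∼ x ∧ ∼ ∼ y)      ≈⟨ ∼-cong (∼-deMorgan (∼ x) (∼ y)) ⟨
    ∼ ∼ (∼ x ∨ ∼ y)        ≈⟨ ∼-involutive _ ⟩
    ∼ x ∨ ∼ y              ∎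

  ∼⊥≈⊤ : ∼ ⊥ ≈ ⊤
  ∼⊥≈⊤ = begin
    ∼ ⊥              ≈⟨ ∧-identityʳ (∼ ⊥) ⟨
    ∼ ⊥ ∧ ⊤          ≈⟨ ∧-cong refl (∼-involutive ⊤) ⟨
    ∼ ⊥ ∧ ∼ ∼ ⊤      ≈⟨ ∼-deMorgan ⊥ (∼ ⊤) ⟨
    ∼ (⊥ ∨ ∼ ⊤)      ≈⟨ ∼-cong (∨-identityˡ (∼ ⊤)) ⟩
    ∼ ∼ ⊤            ≈⟨ ∼-involutive ⊤ ⟩
    ⊤                ∎

  ∼⊤≈⊥ : ∼ ⊤ ≈ ⊥
  ∼⊤≈⊥ = trans (∼-cong (sym ∼⊥≈⊤)) (∼-involutive ⊥)

  -- Both sides are complements of `∼ x`: by De Morgan, `∼` turns the pair `x`, `¬ x` into a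
  -- complementary pair again. This is what makes `*` commute with `¬`, hence a Boolean
  -- automorphism.
  ∼-¬-comm : ∀ x → ∼ (¬ x) ≈ ¬ (∼ x)
  ∼-¬-comm x = complement-unique complementedDeMorganAlgebra
    (trans (sym (∼-deMorgan x (¬ x))) (trans (∼-cong (proj₂ ∨-complement x)) ∼⊤≈⊥))
    (trans (sym (∼-deMorgan₁ x (¬ x))) (trans (∼-cong (proj₂ ∧-complement x)) ∼⊥≈⊤))
    (proj₂ ∧-complement (∼ x))
    (proj₂ ∨-complement (∼ x))

  *-cong : ∀ {x y} → x ≈ y → x * ≈ y *
  *-cong = ¬-cong ∘ ∼-cong

  *-¬ : ∀ x → (¬ x) * ≈ ¬ (x *)
  *-¬ x = ¬-cong (∼-¬-comm x)

  *-involutive : ∀ x → (x *) * ≈ x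
  *-involutive x = trans (*-¬ (∼ x)) (trans (¬-involutive _) (∼-involutive x))

  *-∧ : ∀ x y → (x ∧ y) * ≈ x * ∧ y *
  *-∧ x y = trans (¬-cong (∼-deMorgan₁ x y)) (deMorgan₂ (∼ x) (∼ y))

  ⊤*≈⊤ : ⊤ * ≈ ⊤
  ⊤*≈⊤ = trans (¬-cong ∼⊤≈⊥) ¬⊥≈⊤

  *-zero : ∀ {x} → x ≈ ⊥ → x * ≈ ⊥
  *-zero x≈⊥ = trans (*-cong x≈⊥) (trans (¬-cong ∼⊥≈⊤) ¬⊤≈⊥)

  ∼≈¬* : ∀ x → ∼ x ≈ ¬ (x *)
  ∼≈¬* x = sym (¬-involutive (∼ x))

  signed : Bool → Carrier → Carrier
  signed true  x = x
  signed false x = ¬ x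

  signed-cong : ∀ a {x y} → x ≈ y → signed a x ≈ signed a y
  signed-cong true  x≈y = x≈y
  signed-cong false x≈y = ¬-cong x≈y

  signed-* : ∀ a x → (signed a x) * ≈ signed a (x *)
  signed-* true  x = refl
  signed-* false x = *-¬ x

  signed-¬ : ∀ a x → signed (not a) (¬ x) ≈ signed a x
  signed-¬ true  x = ¬-involutive x
  signed-¬ false x = refl

  signed-disjoint : ∀ a b x → a ≢ b → signed a x ∧ signed b x ≈ ⊥
  signed-disjoint true  true  x a≢b = contradiction ≡.refl a≢b
  signed-disjoint true  false x a≢b = proj₂ ∧-complement x
  signed-disjoint false true  x a≢b = proj₁ ∧-complement x
  signed-disjoint false false x a≢b = contradiction ≡.refl a≢b

  cell : Cell → Carrier → Carrier
  cell (a , b) x = signed a x ∧ signed b (x *)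

  -- Since `*` exchanges `x` and `x *`, the two signs trade places.
  cell-* : ∀ s x → (cell s x) * ≈ cell (swap s) x
  cell-* (a , b) x = begin
    (signed a x ∧ signed b (x *)) *          ≈⟨ *-∧ _ _ ⟩
    (signed a x) * ∧ (signed b (x *)) *      ≈⟨ ∧-cong (signed-* a x) (signed-* b (x *)) ⟩
    signed a (x *) ∧ signed b ((x *) *)      ≈⟨ ∧-comm _ _ ⟩
    signed b ((x *) *) ∧ signed a (x *)      ≈⟨ ∧-cong (signed-cong b (*-involutive x)) refl ⟩
    signed b x ∧ signed a (x *)              ∎

  cell-disjoint : ∀ s t x → s ≢ t → cell s x ∧ cell t x ≈ ⊥
  cell-disjoint (a , b) (a′ , b′) x s≢t with a Bool.≟ a′
  ... | no a≢a′ = trans (interchange _ _ _ _) (zeroˡ (signed-disjoint a a′ x a≢a′))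
  ... | yes ≡.refl = trans (interchange _ _ _ _)
    (zeroʳ (signed-disjoint b b′ (x *) (s≢t ∘ cong (a ,_))))

  -- The nonzero minterms are the atoms of the finite Boole-De Morgan subalgebra generated by `ρ`.
  minterm : ∀ {n} → Vector Carrier n → Vec Cell n → Carrier
  minterm ρ []      = ⊤
  minterm ρ (s ∷ ε) = cell s (head ρ) ∧ minterm (tail ρ) ε

  flip : ∀ {n} → Vec Cell n → Vec Cell n
  flip = Vec.map swap

  flip-involutive : ∀ {n} (ε : Vec Cell n) → flip (flip ε) ≡ ε
  flip-involutive ε = ≡.trans (≡.sym (Vec.map-∘ swap swap ε)) (Vec.map-id ε)

  minterm-* : ∀ {n} (ρ : Vector Carrier n) ε → (minterm ρ ε) * ≈ minterm ρ (flip ε)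
  minterm-* ρ []      = ⊤*≈⊤
  minterm-* ρ (s ∷ ε) =
    trans (*-∧ _ _) (∧-cong (cell-* s (head ρ)) (minterm-* (tail ρ) ε))

  minterm-flip-zero : ∀ {n} (ρ : Vector Carrier n) ε → minterm ρ ε ≈ ⊥ → minterm ρ (flip ε) ≈ ⊥
  minterm-flip-zero ρ ε m≈⊥ = trans (sym (minterm-* ρ ε)) (*-zero m≈⊥)

  minterm-disjoint : ∀ {n} (ρ : Vector Carrier n) ε δ → ε ≢ δ → minterm ρ ε ∧ minterm ρ δ ≈ ⊥
  minterm-disjoint ρ [] [] ε≢δ = contradiction ≡.refl ε≢δ
  minterm-disjoint ρ (s ∷ ε) (t ∷ δ) ε≢δ with Product.≡-dec Bool._≟_ Bool._≟_ s t
  ... | no s≢t = trans (interchange _ _ _ _) (zeroˡ (cell-disjoint s t (head ρ) s≢t))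
  ... | yes ≡.refl = trans (interchange _ _ _ _)
    (zeroʳ (minterm-disjoint (tail ρ) ε δ (ε≢δ ∘ cong (s ∷_))))

  minterm-cell-* : ∀ {n} (ρ : Vector Carrier n) ε s x →
                   minterm ρ ε ∧ cell s x ≈ ⊥ → minterm ρ (flip ε) ∧ cell (swap s) x ≈ ⊥
  minterm-cell-* ρ ε s x m≈⊥ =
    trans (sym (trans (*-∧ _ _) (∧-cong (minterm-* ρ ε) (cell-* s x)))) (*-zero m≈⊥)

  -- The literal of `ρ i` with the sign `proj₁ (lookup ε i)` is a factor of the minterm, so the
  -- opposite literal is disjoint from it: a minterm splits no coordinate.
  minterm-literal : ∀ {n} (ρ : Vector Carrier n) ε i →
                    minterm ρ ε ∧ signed (not (proj₁ (lookup ε i))) (ρ i) ≈ ⊥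
  minterm-literal ρ ((a , b) ∷ ε) zero = begin
    ((signed a x ∧ _) ∧ _) ∧ signed (not a) x  ≈⟨ ∧-comm _ _ ⟩
    signed (not a) x ∧ ((signed a x ∧ _) ∧ _)  ≈⟨ ∧-cong refl (∧-assoc _ _ _) ⟩
    signed (not a) x ∧ (signed a x ∧ _)        ≈⟨ ∧-assoc _ _ _ ⟨
    (signed (not a) x ∧ signed a x) ∧ _
      ≈⟨ zeroˡ (signed-disjoint (not a) a x (Bool.not-¬ {a} ≡.refl ∘ ≡.sym)) ⟩
    ⊥                                          ∎
    where x = head ρ
  minterm-literal ρ (s ∷ ε) (suc i) =
    trans (∧-assoc _ _ _) (zeroʳ (minterm-literal (tail ρ) ε i))

  module _ {q : Level} {P : Pred Carrier q}
           (resp : ∀ {x y} → x ≈ y → P x → P y)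
           (join : ∀ {x y} → P x → P y → P (x ∨ y)) where

    glue-signed : ∀ x u → (∀ a → P (signed a x ∧ u)) → P u
    glue-signed x u h = resp eq (join (h true) (h false))
      where
      eq : x ∧ u ∨ ¬ x ∧ u ≈ u
      eq = trans (sym (∧-distribʳ-∨ u x (¬ x)))
                 (trans (∧-cong (proj₂ ∨-complement x) refl) (∧-identityˡ u))

    glue-cell : ∀ x u → (∀ s → P (cell s x ∧ u)) → P u
    glue-cell x u h = glue-signed (x *) u λ b → glue-signed x _ λ a →
      resp (∧-assoc _ _ _) (h (a , b))

    -- The minterms join to `⊤`, so `u` is the join of its pieces below them. The property is kept
    -- abstract because two instances are needed: being zero, and lying in a generated subalgebra.
    glue-minterm : ∀ {n} (ρ : Vector Carrier n) u → (∀ ε → P (minterm ρ ε ∧ u)) → P u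
    glue-minterm {ℕ.zero} ρ u h = resp (∧-identityˡ u) (h [])
    glue-minterm {nsuc n} ρ u h = glue-minterm (tail ρ) u λ ε → glue-cell (head ρ) _ λ s →
      resp (∧-assoc _ _ _) (h (s ∷ ε))

  zero-resp : ∀ {x y} → x ≈ y → x ≈ ⊥ → y ≈ ⊥
  zero-resp x≈y x≈⊥ = trans (sym x≈y) x≈⊥

  zero-join : ∀ {x y} → x ≈ ⊥ → y ≈ ⊥ → x ∨ y ≈ ⊥
  zero-join x≈⊥ y≈⊥ = trans (∨-cong x≈⊥ y≈⊥) (∨-identityˡ ⊥)

  zero-by-signs : ∀ x u → (∀ a → u ∧ signed a x ≈ ⊥) → u ≈ ⊥
  zero-by-signs x u h =
    glue-signed zero-resp zero-join x u λ a → trans (∧-comm _ _) (h a)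

  zero-by-cells : ∀ x u → (∀ s → u ∧ cell s x ≈ ⊥) → u ≈ ⊥
  zero-by-cells x u h =
    glue-cell zero-resp zero-join x u λ s → trans (∧-comm _ _) (h s)

  zero-by-minterms : ∀ {n} (ρ : Vector Carrier n) u → (∀ ε → minterm ρ ε ∧ u ≈ ⊥) → u ≈ ⊥
  zero-by-minterms = glue-minterm zero-resp zero-join

  prepend : ∀ {n} (xs : List Carrier) → Vector Carrier n → Vector Carrier (length xs + n)
  prepend []       ρ = ρ
  prepend (x ∷ xs) ρ = x ∷ᶠ prepend xs ρ

  -- Dropping the signs of `xs` removes factors, so the minterm of `xs` and `ρ` lies below the
  -- resulting minterm of `ρ`.
  minterm-drop-zero : ∀ {n} xs (ρ : Vector Carrier n) ζ {u} →
                      minterm ρ (drop (length xs) ζ) ∧ u ≈ ⊥ → minterm (prepend xs ρ) ζ ∧ u ≈ ⊥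
  minterm-drop-zero []       ρ ζ        m≈⊥ = m≈⊥
  minterm-drop-zero (x ∷ xs) ρ (s ∷ ζ) m≈⊥ =
    trans (∧-assoc _ _ _) (zeroʳ (minterm-drop-zero xs ρ ζ m≈⊥))

  open SetoidMembership (BooleanAlgebra.setoid booleanAlgebra) public
    using () renaming (_∈_ to _∈ₗ_)

  ∈-prepend : ∀ {n xs x} (ρ : Vector Carrier n) → x ∈ₗ xs → ∃ λ i → x ≈ prepend xs ρ i
  ∈-prepend ρ (here x≈y)   = zero , x≈y
  ∈-prepend ρ (there x∈xs) = let i , x≈ = ∈-prepend ρ x∈xs in suc i , x≈

-- Enumeration of the sign vectors.

cells : ∀ n → List (Vec Cell n)
cells ℕ.zero   = [] ∷ []
cells (nsuc n) = cartesianProductWith _∷_ (cartesianProduct signs signs) (cells n)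
  where signs = true ∷ false ∷ []

∈-signs : ∀ a → a ListMembership.∈ true ∷ false ∷ []
∈-signs true  = here ≡.refl
∈-signs false = there (here ≡.refl)

∈-cells : ∀ {n} (ε : Vec Cell n) → ε ListMembership.∈ cells n
∈-cells []            = here ≡.refl
∈-cells ((a , b) ∷ ε) =
  ∈-cartesianProductWith⁺ _∷_ (∈-cartesianProduct⁺ (∈-signs a) (∈-signs b)) (∈-cells ε)

-- Freedom from repetition makes distinct indices carry distinct sign vectors, hence disjoint
-- minterms, as the axioms demand.
cells-unique : ∀ n → Unique (cells n)
cells-unique ℕ.zero   = All.[] ∷ []
cells-unique (nsuc n) = Unique.cartesianProductWith⁺ _∷_ Vec.∷-injective
  (Unique.cartesianProduct⁺ signs-unique signs-unique) (cells-unique n)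
  where
  signs-unique : Unique (true ∷ false ∷ [])
  signs-unique = ((λ ()) All.∷ All.[]) ∷ All.[] ∷ []

lookup-injective : ∀ {a} {A : Set a} {xs : List A} → Unique xs →
                   ∀ i j → List.lookup xs i ≡ List.lookup xs j → i ≡ j
lookup-injective (x∉xs ∷ u) zero    zero    eq = ≡.refl
lookup-injective (x∉xs ∷ u) zero    (suc j) eq = contradiction eq (All.lookup x∉xs (∈-lookup j))
lookup-injective (x∉xs ∷ u) (suc i) zero    eq =
  contradiction (≡.sym eq) (All.lookup x∉xs (∈-lookup i))
lookup-injective (x∉xs ∷ u) (suc i) (suc j) eq = cong suc (lookup-injective u i j eq)

-- Realization of prescribed one-variable types.

module ExistentiallyClosed {c ℓ : Level} (D : BooleDeMorganAlgebra c ℓ) (model : IsModelECBDA D)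
         (_≟_ : Decidable (BooleDeMorganAlgebra._≈_ D)) where
  open Algebra D

  -- `Z ζ s` prescribes whether the sought element has its cell `s` vanish on the minterm `ζ`.
  -- `Z-flip` is compatibility with `*`; `Z-proper` says that the four cells, which join to `⊤`,
  -- cannot all vanish on a nonzero minterm.
  module Realization {n : ℕ} (τ : Vector Carrier n) (Z : Vec Cell n → Cell → Bool)
           (Z-flip : ∀ ζ s → Z (flip ζ) (swap s) ≡ Z ζ s)
           (Z-proper : ∀ ζ → (∀ s → Z ζ s ≡ true) → minterm τ ζ ≈ ⊥) where

    NonZero : Vec Cell n → Set ℓ
    NonZero ζ = Not (minterm τ ζ ≈ ⊥)

    NonZero? : ∀ ζ → Dec (NonZero ζ)
    NonZero? ζ = ¬? (minterm τ ζ ≟ ⊥)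

    support : List (Vec Cell n)
    support = filter NonZero? (cells n)

    k : ℕ
    k = length support

    label : Fin k → Vec Cell n
    label = List.lookup support

    index : ∀ ζ → NonZero ζ → Fin k
    index ζ nz = Any.index (∈-filter⁺ NonZero? (∈-cells ζ) nz)

    label-index : ∀ ζ nz → label (index ζ nz) ≡ ζ
    label-index ζ nz = ≡.sym (lookup-index (∈-filter⁺ NonZero? (∈-cells ζ) nz))

    label-nonZero : ∀ i → NonZero (label i)
    label-nonZero i = proj₂ (∈-filter⁻ NonZero? {xs = cells n} (∈-lookup i))

    label-injective : ∀ i j → label i ≡ label j → i ≡ j
    label-injective = lookup-injective (Unique.filter⁺ NonZero? (cells-unique n))

    flip-nonZero : ∀ ζ → NonZero ζ → NonZero (flip ζ)
    flip-nonZero ζ nz m≈⊥ =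
      nz (subst (λ ε → minterm τ ε ≈ ⊥) (flip-involutive ζ) (minterm-flip-zero τ (flip ζ) m≈⊥))

    -- The permutation induced by `*` on the nonzero minterms, which plays the part of `σ` in the
    -- axioms.
    star : Fin k → Fin k
    star i = index (flip (label i)) (flip-nonZero (label i) (label-nonZero i))

    label-star : ∀ i → label (star i) ≡ flip (label i)
    label-star i = label-index _ _

    star-involutive : ∀ i → star (star i) ≡ i
    star-involutive i = label-injective _ _ (≡.trans (label-star (star i))
      (≡.trans (cong flip (label-star i)) (flip-involutive (label i))))

    σ : Permutation′ k
    σ = permutation star star star-involutive star-involutive

    y : Vector Carrier k
    y i = minterm τ (label i)

    y≤⋁y : ∀ {m} (u : Vector Carrier m) i → u i ∧ ¬ (foldr _∨_ ⊥ u) ≈ ⊥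
    y≤⋁y u zero    = trans (∧-cong refl (deMorgan₂ _ _))
      (trans (sym (∧-assoc _ _ _)) (zeroˡ (proj₂ ∧-complement _)))
    y≤⋁y u (suc i) = trans (∧-cong refl (deMorgan₂ _ _))
      (trans (x∙yz≈y∙xz _ _ _) (zeroʳ (y≤⋁y (tail u) i)))

    -- The complement of the join is disjoint from every minterm: from the nonzero ones because they
    -- are terms of the join, from the others trivially.
    ⋁y≈⊤ : foldr _∨_ ⊥ y ≈ ⊤
    ⋁y≈⊤ = trans (sym (¬-involutive _)) (trans (¬-cong (zero-by-minterms τ _ below)) ¬⊥≈⊤)
      where
      below : ∀ ζ → minterm τ ζ ∧ ¬ (foldr _∨_ ⊥ y) ≈ ⊥
      below ζ with minterm τ ζ ≟ ⊥
      ... | yes m≈⊥ = zeroˡ m≈⊥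
      ... | no  nz  = subst (λ ε → minterm τ ε ∧ ¬ (foldr _∨_ ⊥ y) ≈ ⊥)
                            (label-index ζ nz) (y≤⋁y y (index ζ nz))

    I : Cell → Subset k
    I s = Vec.tabulate (λ i → Z (label i) s)

    ∈I⇒Z : ∀ s i → i ∈ I s → Z (label i) s ≡ true
    ∈I⇒Z s i i∈I = ≡.trans (≡.sym (Vec.lookup∘tabulate _ i)) (Vec.[]=⇒lookup i∈I)

    Z⇒∈I : ∀ s i → Z (label i) s ≡ true → i ∈ I s
    Z⇒∈I s i z = Vec.lookup⇒[]= i _ (≡.trans (Vec.lookup∘tabulate _ i) z)

    Z-star : ∀ s i → Z (label (star i)) (swap s) ≡ Z (label i) s
    Z-star s i = ≡.trans (cong (λ ζ → Z ζ (swap s)) (label-star i)) (Z-flip (label i) s)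

    -- `star` is its own inverse, so the image is a preimage, and `Z-flip` turns it into a swap of
    -- signs. The symmetric sign pairs of `I₂` and `I₃` thus give invariant sets.
    image-I : ∀ s → image σ (I s) ≡ I (swap s)
    image-I s = Vec.tabulate-cong λ i → ≡.trans (Vec.lookup∘tabulate _ (star i)) (Z-star (swap s) i)

    ∈-image⁻ : ∀ (J : Subset k) i → i ∈ image σ J → star i ∈ J
    ∈-image⁻ J i i∈ = Vec.lookup⇒[]= (star i) J
      (≡.trans (≡.sym (Vec.lookup∘tabulate _ i)) (Vec.[]=⇒lookup i∈))

    -- As `∼ x` is `¬ (x *)`, the elements `x ∧ ∼ x`, `x ∧ x *` and `¬ x ∧ ∼ x` of the axioms are
    -- the cells with these sign pairs.
    I₁ I₂ I₃ : Subset k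
    I₁ = I (true , false)
    I₂ = I (true , true)
    I₃ = I (false , false)

    -- An index violating the third condition would have all four cells prescribed to vanish on its
    -- nonzero minterm, against `Z-proper`.
    consistent : Consistent σ I₁ I₂ I₃
    consistent = image-I _ , image-I _ , Empty-unique λ (i , i∈) →
      let i∈J , i∈σJ = x∈p∩q⁻ (I₁ ∩ I₂ ∩ I₃) _ i∈
          i∈I₁ , i∈I₂₃ = x∈p∩q⁻ I₁ _ i∈J
          i∈I₂ , i∈I₃ = x∈p∩q⁻ I₂ I₃ i∈I₂₃
          σi∈I₁ , _ = x∈p∩q⁻ I₁ _ (∈-image⁻ _ i i∈σJ)
      in label-nonZero i (Z-proper (label i) λ
        { (true  , true)  → ∈I⇒Z _ i i∈I₂
        ; (true  , false) → ∈I⇒Z _ i i∈I₁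
        -- The fourth cell at `i` is the swap of the cell of `I₁` at `star i`; this is where
        -- membership in the image is used.
        ; (false , true)  → ≡.trans (≡.sym (Z-star _ i)) (∈I⇒Z _ (star i) σi∈I₁)
        ; (false , false) → ∈I⇒Z _ i i∈I₃ })

    RealizedBy : Carrier → Cell → Set ℓ
    RealizedBy x s = ∀ ζ → NonZero ζ → minterm τ ζ ∧ cell s x ≈ ⊥ ⇔ Z ζ s ≡ true

    realized : ∀ {x} s {t} → t ≈ cell s x →
               VanishesExactlyOn isDeMorganAlgebra (I s) y t → RealizedBy x s
    realized {x} s {t} t≈ (on , off) ζ nz =
      subst (λ ε → minterm τ ε ∧ cell s x ≈ ⊥ ⇔ Z ε s ≡ true) (label-index ζ nz)
        (mk⇔ fwd (λ z → trans (∧-cong refl (sym t≈)) (on i (Z⇒∈I s i z))))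
      where
      i = index ζ nz
      fwd : y i ∧ cell s x ≈ ⊥ → Z (label i) s ≡ true
      fwd m≈⊥ with Z (label i) s Bool.≟ true
      ... | yes z  = z
      ... | no  ¬z = contradiction (trans (∧-cong refl t≈) m≈⊥) (off i (¬z ∘ ∈I⇒Z s i))

    -- The axioms leave out the cell ¬ x ∧ x *: the involution * maps it to x ∧ ¬ (x *).
    realized-swap : ∀ {x} s → RealizedBy x s → RealizedBy x (swap s)
    realized-swap {x} s r ζ nz = mk⇔
      (λ m≈⊥ → ≡.trans (≡.sym (Z-flip ζ (swap s)))
                       (to (r (flip ζ) nz′) (minterm-cell-* τ ζ (swap s) x m≈⊥)))
      (λ z → subst (λ ε → minterm τ ε ∧ cell (swap s) x ≈ ⊥) (flip-involutive ζ)
        (minterm-cell-* τ (flip ζ) s x (from (r (flip ζ) nz′) (≡.trans (Z-flip ζ (swap s)) z))))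
      where nz′ = flip-nonZero ζ nz

    realize : ∃ λ x → ∀ s → RealizedBy x s
    realize with 1 ≤? k
    -- Without nonzero minterms the algebra is trivial and the axioms, which start at one block, say
    -- nothing; any element then serves, here `⊤`.
    ... | no  k<1 = ⊤ , λ s ζ nz → contradiction (Fin⇒1≤ (index ζ nz)) k<1
      where
      Fin⇒1≤ : ∀ {m} → Fin m → 1 ≤ m
      Fin⇒1≤ zero    = s≤s z≤n
      Fin⇒1≤ (suc i) = s≤s z≤n
    ... | yes 1≤k =
      let x , v₁ , v₂ , v₃ = model k 1≤k σ star-involutive I₁ I₂ I₃ consistent y label-nonZero ⋁y≈⊤
            (λ i j i≢j → minterm-disjoint τ _ _ (i≢j ∘ label-injective i j))
            (λ i → trans (minterm-* τ (label i)) (reflexive (cong (minterm τ) (≡.sym (label-star i)))))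
          r₁ = realized (true , false) (∧-cong refl (∼≈¬* x)) v₁
      in x , λ
        { (true  , true)  → realized (true , true) refl v₂
        ; (true  , false) → r₁
        ; (false , true)  → realized-swap (true , false) r₁
        ; (false , false) → realized (false , false) (∧-cong refl (∼≈¬* x)) v₃ }

  -- Tuples with the same vanishing minterms.

  infix 4 _∼ᵐ_

  _∼ᵐ_ : ∀ {n} → Rel (Vector Carrier n) ℓ
  ρ ∼ᵐ ρ′ = ∀ ε → minterm ρ ε ≈ ⊥ ⇔ minterm ρ′ ε ≈ ⊥

  ∼ᵐ-sym : ∀ {n} {ρ ρ′ : Vector Carrier n} → ρ ∼ᵐ ρ′ → ρ′ ∼ᵐ ρ
  ∼ᵐ-sym r ε = mk⇔ (from (r ε)) (to (r ε))

  -- The bit is the truth value of e on the minterm ε.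
  Corresponding : ∀ {n} (ρ ρ′ : Vector Carrier n) → Rel Carrier ℓ
  Corresponding ρ ρ′ e e′ =
    ∀ ε → ∃ λ a → minterm ρ ε ∧ signed (not a) e ≈ ⊥ × minterm ρ′ ε ∧ signed (not a) e′ ≈ ⊥

  module _ {n : ℕ} {ρ ρ′ : Vector Carrier n} where

    corr-var : ∀ i → Corresponding ρ ρ′ (ρ i) (ρ′ i)
    corr-var i ε = proj₁ (lookup ε i) , minterm-literal ρ ε i , minterm-literal ρ′ ε i

    corr-resp : ∀ {e e′ f f′} → e ≈ f → e′ ≈ f′ → Corresponding ρ ρ′ e e′ → Corresponding ρ ρ′ f f′
    corr-resp e≈f e′≈f′ h ε =
      let a , z , z′ = h ε
      in a , trans (∧-cong refl (signed-cong (not a) (sym e≈f))) z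
           , trans (∧-cong refl (signed-cong (not a) (sym e′≈f′))) z′

    corr-bot : Corresponding ρ ρ′ ⊥ ⊥
    corr-bot ε = false , ∧-zeroʳ _ , ∧-zeroʳ _

    corr-comp : ∀ {e e′} → Corresponding ρ ρ′ e e′ → Corresponding ρ ρ′ (¬ e) (¬ e′)
    corr-comp {e} {e′} h ε =
      let a , z , z′ = h ε
      in not a , trans (∧-cong refl (signed-¬ (not a) e)) z
               , trans (∧-cong refl (signed-¬ (not a) e′)) z′

    corr-top : Corresponding ρ ρ′ ⊤ ⊤
    corr-top = corr-resp ¬⊥≈⊤ ¬⊥≈⊤ (corr-comp corr-bot)

    corr-join : ∀ {e e′ f f′} → Corresponding ρ ρ′ e e′ → Corresponding ρ ρ′ f f′ →
                Corresponding ρ ρ′ (e ∨ f) (e′ ∨ f′)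
    corr-join h k ε with h ε | k ε
    ... | true  , z , z′ | _ = true , aboveˡ z , aboveˡ z′
      where
      aboveˡ : ∀ {m e f} → m ∧ ¬ e ≈ ⊥ → m ∧ ¬ (e ∨ f) ≈ ⊥
      aboveˡ z = trans (∧-cong refl (deMorgan₂ _ _)) (trans (sym (∧-assoc _ _ _)) (zeroˡ z))
    ... | false , _ | true , z , z′ = true , aboveʳ z , aboveʳ z′
      where
      aboveʳ : ∀ {m e f} → m ∧ ¬ f ≈ ⊥ → m ∧ ¬ (e ∨ f) ≈ ⊥
      aboveʳ z = trans (∧-cong refl (deMorgan₂ _ _)) (trans (x∙yz≈y∙xz _ _ _) (zeroʳ z))
    ... | false , z , z′ | false , w , w′ = false , disjoint z w , disjoint z′ w′
      where
      disjoint : ∀ {m e f} → m ∧ e ≈ ⊥ → m ∧ f ≈ ⊥ → m ∧ (e ∨ f) ≈ ⊥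
      disjoint z w = trans (∧-distribˡ-∨ _ _ _) (zero-join z w)

    corr-meet : ∀ {e e′ f f′} → Corresponding ρ ρ′ e e′ → Corresponding ρ ρ′ f f′ →
                Corresponding ρ ρ′ (e ∧ f) (e′ ∧ f′)
    corr-meet h k = corr-resp (eq _ _) (eq _ _) (corr-comp (corr-join (corr-comp h) (corr-comp k)))
      where
      eq : ∀ e f → ¬ (¬ e ∨ ¬ f) ≈ e ∧ f
      eq e f = trans (deMorgan₂ _ _) (∧-cong (¬-involutive e) (¬-involutive f))

    -- The truth value of `e *` on `ε` is that of `e` on `flip ε`, because `*` carries the minterm
    -- of `flip ε` to that of `ε`.
    corr-* : ∀ {e e′} → Corresponding ρ ρ′ e e′ → Corresponding ρ ρ′ (e *) (e′ *)
    corr-* h ε =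
      let a , z , z′ = h (flip ε) in a , flipped ρ a z , flipped ρ′ a z′
      where
      flipped : ∀ (π : Vector Carrier n) a {e} → minterm π (flip ε) ∧ signed (not a) e ≈ ⊥ →
                minterm π ε ∧ signed (not a) (e *) ≈ ⊥
      flipped π a {e} z = trans (sym (trans (*-∧ _ _) (∧-cong
        (trans (minterm-* π (flip ε)) (reflexive (cong (minterm π) (flip-involutive ε))))
        (signed-* (not a) e)))) (*-zero z)

    corr-bar : ∀ {e e′} → Corresponding ρ ρ′ e e′ → Corresponding ρ ρ′ (∼ e) (∼ e′)
    corr-bar h = corr-resp (sym (∼≈¬* _)) (sym (∼≈¬* _)) (corr-comp (corr-* h))

    -- Where the bit is false, `e′` is already disjoint from the minterm. Where it is true, `e ≈ ⊥`
    -- forces the minterm of `ρ` to vanish, and then so does that of `ρ′`.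
    corr-zero : ρ ∼ᵐ ρ′ → ∀ {e e′} → Corresponding ρ ρ′ e e′ → e ≈ ⊥ → e′ ≈ ⊥
    corr-zero r {e} {e′} h e≈⊥ = zero-by-minterms ρ′ e′ vanish
      where
      vanish : ∀ ε → minterm ρ′ ε ∧ e′ ≈ ⊥
      vanish ε with h ε
      ... | false , _ , z′ = z′
      ... | true  , z , _  = zeroˡ (to (r ε) (trans (sym (∧-identityʳ _))
        (trans (∧-cong refl (sym (trans (¬-cong e≈⊥) ¬⊥≈⊤))) z)))

    corr-≈ : ρ ∼ᵐ ρ′ → ∀ {e e′ f f′} → Corresponding ρ ρ′ e e′ → Corresponding ρ ρ′ f f′ →
             e ≈ f → e′ ≈ f′
    corr-≈ r h k e≈f = ∧-¬-zero⇒≈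
      (corr-zero r (corr-meet h (corr-comp k)) (trans (∧-cong e≈f refl) (proj₂ ∧-complement _)))
      (corr-zero r (corr-meet k (corr-comp h)) (trans (∧-cong (sym e≈f) refl) (proj₂ ∧-complement _)))

  -- Transport of the type of an element to another tuple.

  vanishes : ∀ {n} → Vector Carrier n → Carrier → Vec Cell n → Cell → Bool
  vanishes ρ x ε s = does ((minterm ρ ε ∧ cell s x) ≟ ⊥)

  vanishes-flip : ∀ {n} (ρ : Vector Carrier n) x ε s → vanishes ρ x (flip ε) (swap s) ≡ vanishes ρ x ε s
  vanishes-flip ρ x ε s = does-⇔ (mk⇔
    (λ z → subst (λ δ → minterm ρ δ ∧ cell s x ≈ ⊥) (flip-involutive ε)
             (minterm-cell-* ρ (flip ε) (swap s) x z))
    (minterm-cell-* ρ ε s x))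
    ((minterm ρ (flip ε) ∧ cell (swap s) x) ≟ ⊥) ((minterm ρ ε ∧ cell s x) ≟ ⊥)

  vanishes⇒≈⊥ : ∀ {n} (ρ : Vector Carrier n) x ε s → vanishes ρ x ε s ≡ true →
               minterm ρ ε ∧ cell s x ≈ ⊥
  vanishes⇒≈⊥ ρ x ε s v with yes z ← (minterm ρ ε ∧ cell s x) ≟ ⊥ = z

  ≈⊥⇒vanishes : ∀ {n} (ρ : Vector Carrier n) x ε s → minterm ρ ε ∧ cell s x ≈ ⊥ →
               vanishes ρ x ε s ≡ true
  ≈⊥⇒vanishes ρ x ε s z = dec-true (_ ≟ _) z

  -- The vanishing pattern of `x` over `ρ` is pulled back along `r` and realized over `τ`. With `r`
  -- the identity this gives the back-and-forth step; with `r` forgetting the signs of `xs` it gives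
  -- a copy of `x` outside `xs`.
  realize-type : ∀ {k n} (τ : Vector Carrier k) (ρ : Vector Carrier n) (r : Vec Cell k → Vec Cell n) →
    (∀ ζ → r (flip ζ) ≡ flip (r ζ)) → (∀ ζ → minterm ρ (r ζ) ≈ ⊥ → minterm τ ζ ≈ ⊥) →
    ∀ x → ∃ λ x′ → ∀ ζ s → Not (minterm τ ζ ≈ ⊥) →
    minterm τ ζ ∧ cell s x′ ≈ ⊥ ⇔ minterm ρ (r ζ) ∧ cell s x ≈ ⊥
  realize-type τ ρ r r-flip r-zero x =
    let x′ , realized = realize
    in x′ , λ ζ s nz → mk⇔ (vanishes⇒≈⊥ ρ x (r ζ) s ∘ to (realized s ζ nz))
                           (from (realized s ζ nz) ∘ ≈⊥⇒vanishes ρ x (r ζ) s)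
    where
    open Realization τ (vanishes ρ x ∘ r)
      (λ ζ s → ≡.trans (cong (λ δ → vanishes ρ x δ (swap s)) (r-flip ζ)) (vanishes-flip ρ x (r ζ) s))
      -- If all four cells of `x` vanish on `r ζ`, that minterm of `ρ` is zero, and `r-zero` passes
      -- this on to `τ`.
      (λ ζ all → r-zero ζ (zero-by-cells x _ λ s → vanishes⇒≈⊥ ρ x (r ζ) s (all s)))

  forth : ∀ {n} {ρ ρ′ : Vector Carrier n} → ρ ∼ᵐ ρ′ → ∀ x → ∃ λ x′ → (x ∷ᶠ ρ) ∼ᵐ (x′ ∷ᶠ ρ′)
  forth {ρ = ρ} {ρ′} r x =
    let x′ , realizes = realize-type ρ′ ρ (λ ζ → ζ) (λ _ → ≡.refl) (to ∘ r) x
    in x′ , equivalent x′ realizes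
    where
    equivalent : ∀ x′ →
      (∀ ζ s → Not (minterm ρ′ ζ ≈ ⊥) → minterm ρ′ ζ ∧ cell s x′ ≈ ⊥ ⇔ minterm ρ ζ ∧ cell s x ≈ ⊥) →
      (x ∷ᶠ ρ) ∼ᵐ (x′ ∷ᶠ ρ′)
    equivalent x′ realizes (s ∷ ε) with minterm ρ′ ε ≟ ⊥
    -- The realization is silent about zero minterms, but these vanish for both tuples.
    ... | yes m≈⊥ = mk⇔ (λ _ → zeroʳ m≈⊥) (λ _ → zeroʳ (from (r ε) m≈⊥))
    ... | no  nz  = mk⇔
      (λ z → trans (∧-comm _ _) (from (realizes ε s nz) (trans (∧-comm _ _) z)))
      (λ z → trans (∧-comm _ _) (to (realizes ε s nz) (trans (∧-comm _ _) z)))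

  -- On each nonzero minterm of `xs` and `ρ`, the element `x′` meets the same cells as `x` meets on
  -- the coarser minterm of `ρ`, whatever `xs` does there: `x′` is a copy of `x` free from `xs`.
  module FreeExtension {n : ℕ} (ρ : Vector Carrier n) (xs : List Carrier) (x x′ : Carrier)
    (realizes : ∀ ζ s → Not (minterm (prepend xs ρ) ζ ≈ ⊥) →
      minterm (prepend xs ρ) ζ ∧ cell s x′ ≈ ⊥ ⇔ minterm ρ (drop (length xs) ζ) ∧ cell s x ≈ ⊥) where

    restrict : Vec Cell (length xs + n) → Vec Cell n
    restrict = drop (length xs)

    τ : Vector Carrier (length xs + n)
    τ = prepend xs ρ

    -- The minterms of `xs` and `ρ` that refine `δ` cover the minterm `δ`; all the others are
    -- disjoint from it.
    zero-by-refinement : ∀ δ u → (∀ ζ → restrict ζ ≡ δ → minterm τ ζ ∧ u ≈ ⊥) → minterm ρ δ ∧ u ≈ ⊥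
    zero-by-refinement δ u h = zero-by-minterms τ _ vanish
      where
      vanish : ∀ ζ → minterm τ ζ ∧ (minterm ρ δ ∧ u) ≈ ⊥
      vanish ζ with Vec.≡-dec (Product.≡-dec Bool._≟_ Bool._≟_) (restrict ζ) δ
      ... | yes eq = trans (x∙yz≈y∙xz _ _ _) (zeroʳ (h ζ eq))
      ... | no  ne = minterm-drop-zero xs ρ ζ
        (trans (sym (∧-assoc _ _ _)) (zeroˡ (minterm-disjoint ρ _ _ ne)))

    equivalent : (x ∷ᶠ ρ) ∼ᵐ (x′ ∷ᶠ ρ)
    equivalent (s ∷ δ) = mk⇔
      (λ z → trans (∧-comm _ _) (zero-by-refinement δ _ λ { ζ ≡.refl →
               forward ζ (trans (∧-comm _ _) z) }))
      (λ z → trans (∧-comm _ _) (zero-by-refinement δ _ λ { ζ ≡.refl →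
               backward ζ (trans (∧-comm _ _) z) }))
      where
      forward : ∀ ζ → minterm ρ (restrict ζ) ∧ cell s x ≈ ⊥ → minterm τ ζ ∧ cell s x′ ≈ ⊥
      forward ζ z with minterm τ ζ ≟ ⊥
      ... | yes m≈⊥ = zeroˡ m≈⊥
      ... | no  nz  = from (realizes ζ s nz) z

      backward : ∀ ζ → minterm ρ (restrict ζ) ∧ cell s x′ ≈ ⊥ → minterm τ ζ ∧ cell s x ≈ ⊥
      backward ζ z with minterm τ ζ ≟ ⊥
      ... | yes m≈⊥ = zeroˡ m≈⊥
      -- Vanishing for `x′` descends to the refinement `ζ`, returns to the coarse minterm as
      -- vanishing for `x`, and descends again.
      ... | no  nz  = minterm-drop-zero xs ρ ζ (to (realizes ζ s nz) (minterm-drop-zero xs ρ ζ z))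

    -- A minterm of xs and ρ never splits a member of xs, whereas x′ is split wherever x is.
    avoids : ∀ ε → Not (minterm ρ ε ∧ x ≈ ⊥) → Not (minterm ρ ε ∧ ¬ x ≈ ⊥) → Not (x′ ∈ₗ xs)
    avoids ε m∧x≉⊥ m∧¬x≉⊥ x′∈xs =
      m∧x≉⊥ (zero-by-refinement ε x λ ζ eq → zeroˡ (vanish ζ eq))
      where
      i   = proj₁ (∈-prepend ρ x′∈xs)
      x′≈ = proj₂ (∈-prepend ρ x′∈xs)

      not-split : ∀ a → Not (minterm ρ ε ∧ signed a x ≈ ⊥)
      not-split true  = m∧x≉⊥
      not-split false = m∧¬x≉⊥

      vanish : ∀ ζ → restrict ζ ≡ ε → minterm τ ζ ≈ ⊥
      vanish ζ ≡.refl with minterm τ ζ ≟ ⊥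
      ... | yes m≈⊥ = m≈⊥
      -- As `x′` equals a coordinate of `τ`, the minterm `ζ` misses `signed a x′`, hence both of its
      -- cells with first sign `a`. The realization makes these cells of `x` vanish on `ε`, so `ε`
      -- would not be split by `x`.
      ... | no  nz  = contradiction
        (zero-by-signs (x *) _ λ b → trans (∧-assoc _ _ _)
          (to (realizes ζ (a , b) nz) (trans (sym (∧-assoc _ _ _)) (zeroˡ
            (trans (∧-cong refl (signed-cong a x′≈)) (minterm-literal τ ζ i))))))
        (not-split a)
        where a = not (proj₁ (lookup ζ i))

  avoid : ∀ {n} (ρ : Vector Carrier n) x ε →
          Not (minterm ρ ε ∧ x ≈ ⊥) → Not (minterm ρ ε ∧ ¬ x ≈ ⊥) →
          (xs : List Carrier) → ∃ λ x′ → (x ∷ᶠ ρ) ∼ᵐ (x′ ∷ᶠ ρ) × Not (x′ ∈ₗ xs)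
  avoid ρ x ε m∧x≉⊥ m∧¬x≉⊥ xs =
    let x′ , realizes = realize-type (prepend xs ρ) ρ (drop (length xs)) (Vec.drop-map swap (length xs))
          (λ ζ z → trans (sym (∧-identityʳ _)) (minterm-drop-zero xs ρ ζ (zeroˡ z))) x
        open FreeExtension ρ xs x x′ realizes
    in x′ , equivalent , avoids ε m∧x≉⊥ m∧¬x≉⊥

  -- Elements that split no minterm.

  minterm-generated : ∀ {p n} {A : Pred Carrier p} (ρ : Vector Carrier n) → (∀ i → A (ρ i)) →
                      ∀ ε → Generated D A (minterm ρ ε)
  minterm-generated ρ ρ∈A []            = top
  minterm-generated {A = A} ρ ρ∈A ((a , b) ∷ ε) = meet
    (meet (sign a (gen (ρ∈A zero))) (sign b (comp (bar (gen (ρ∈A zero))))))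
    (minterm-generated (tail ρ) (ρ∈A ∘ suc) ε)
    where
    sign : ∀ a {x} → Generated D A x → Generated D A (signed a x)
    sign true  g = g
    sign false g = comp g

  -- Such an `x` is the join of the minterms below it, and there are finitely many of them.
  generated-by-minterms : ∀ {p n} {A : Pred Carrier p} (ρ : Vector Carrier n) → (∀ i → A (ρ i)) → ∀ x →
    (∀ ε → minterm ρ ε ∧ x ≈ ⊥ ⊎ minterm ρ ε ∧ ¬ x ≈ ⊥) → Generated D A x
  generated-by-minterms {A = A} ρ ρ∈A x h = glue-minterm resp join ρ x below
    where
    below : ∀ ε → Generated D A (minterm ρ ε ∧ x)
    below ε with h ε
    ... | inj₁ z = resp (sym z) bot
    ... | inj₂ z = resp (sym m∧x≈m) (minterm-generated ρ ρ∈A ε)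
      where
      m = minterm ρ ε
      m∧x≈m : m ∧ x ≈ m
      m∧x≈m = begin
        m ∧ x              ≈⟨ ∨-identityʳ _ ⟨
        m ∧ x ∨ ⊥          ≈⟨ ∨-cong refl z ⟨
        m ∧ x ∨ m ∧ ¬ x    ≈⟨ ∧-distribˡ-∨ m x (¬ x) ⟨
        m ∧ (x ∨ ¬ x)      ≈⟨ ∧-cong refl (proj₂ ∨-complement x) ⟩
        m ∧ ⊤              ≈⟨ ∧-identityʳ m ⟩
        m                  ∎

-- Renaming of variables in formulas.

module _ {L : Signature} where

  renameTerm : ∀ {m n} → (Fin m → Fin n) → Term L m → Term L n
  renameTerm f (var i)    = var (f i)
  renameTerm f (app g ts) = app g (λ i → renameTerm f (ts i))

  rename : ∀ {m n} → (Fin m → Fin n) → Formula L m → Formula L n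
  rename f (s ≗ t)   = renameTerm f s ≗ renameTerm f t
  rename f falsum    = falsum
  rename f (φ and ψ) = rename f φ and rename f ψ
  rename f (φ or ψ)  = rename f φ or rename f ψ
  rename f (φ imp ψ) = rename f φ imp rename f ψ
  rename f (all φ)   = all (rename (liftFin 1 f) φ)
  rename f (ex φ)    = ex (rename (liftFin 1 f) φ)

-- Definable closure in an arbitrary structure.

module Definability {L : Signature} {c ℓ : Level} (M : Structure L c ℓ) where
  open Structure M
  open IsEquivalence isEquivalence

  -- Pointwise agreement up to `≈` avoids equations between environments, which are functions.
  _agrees-with_along_ : ∀ {m n} → Vector Carrier n → Vector Carrier m → (Fin m → Fin n) → Set ℓ
  ρ′ agrees-with ρ along f = ∀ i → ρ′ (f i) ≈ ρ i

  agrees-∷ : ∀ {m n} {ρ′ : Vector Carrier n} {ρ : Vector Carrier m} {f} →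
             ρ′ agrees-with ρ along f → ∀ x → (x ∷ᶠ ρ′) agrees-with (x ∷ᶠ ρ) along liftFin 1 f
  agrees-∷ h x zero    = refl
  agrees-∷ h x (suc i) = h i

  eval-rename : ∀ {m n} {ρ′ : Vector Carrier n} {ρ : Vector Carrier m} {f} →
                ρ′ agrees-with ρ along f → ∀ t → eval M ρ′ (renameTerm f t) ≈ eval M ρ t
  eval-rename h (var i)    = h i
  eval-rename h (app g ts) = interp-cong g (λ i → eval-rename h (ts i))

  Sat-rename : ∀ {m n} {ρ′ : Vector Carrier n} {ρ : Vector Carrier m} {f} →
               ρ′ agrees-with ρ along f → ∀ φ → Sat M ρ′ (rename f φ) ⇔ Sat M ρ φ
  Sat-rename h (s ≗ t) = mk⇔
    (λ (lift e) → lift (trans (sym (eval-rename h s)) (trans e (eval-rename h t))))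
    (λ (lift e) → lift (trans (eval-rename h s) (trans e (sym (eval-rename h t)))))
  Sat-rename h falsum    = mk⇔ (λ ()) (λ ())
  Sat-rename h (φ and ψ) = Sat-rename h φ ×-⇔ Sat-rename h ψ
  Sat-rename h (φ or ψ)  = Sat-rename h φ ⊎-⇔ Sat-rename h ψ
  Sat-rename h (φ imp ψ) = →-cong-⇔ (Sat-rename h φ) (Sat-rename h ψ)
  Sat-rename h (all φ)   = mk⇔
    (λ p x → to (Sat-rename (agrees-∷ h x) φ) (p x))
    (λ p x → from (Sat-rename (agrees-∷ h x) φ) (p x))
  Sat-rename h (ex φ)    = mk⇔
    (λ (x , p) → x , to (Sat-rename (agrees-∷ h x) φ) p)
    (λ (x , p) → x , from (Sat-rename (agrees-∷ h x) φ) p)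

  module _ {p : Level} {A : Pred Carrier p} where

    dcl⊆acl : dcl M A ⊆ acl M A
    dcl⊆acl (S , (a , h) , x∈S) =
      S , (a ∷ [] , λ x → mk⇔ (here ∘ to (h x)) (λ { (here x≈a) → from (h x) x≈a ; (there ()) })) , x∈S

    dcl-resp : ∀ {x y} → x ≈ y → dcl M A x → dcl M A y
    dcl-resp x≈y (S , (a , h) , x∈S) =
      S , (a , h) , from (h _) (trans (sym x≈y) (to (h _) x∈S))

    ⊆dcl : A ⊆ dcl M A
    ⊆dcl {x} x∈A =
      record { formula = var zero ≗ var (suc zero) ; params = x ∷ᶠ []ᶠ ; params∈A = λ { zero → x∈A } }
      , (x , λ y → mk⇔ lower lift) , lift refl

    dcl-definable₀ : (θ : Formula L 1) (a : Carrier) →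
                     (∀ x → Sat M (x ∷ᶠ []ᶠ) θ ⇔ x ≈ a) → dcl M A a
    dcl-definable₀ θ a h =
      record { formula = θ ; params = []ᶠ ; params∈A = λ () } , (a , h) , from (h a) refl

    -- The context of the matrix of the defining formula is z , y , x , parameters of y , parameters of z.
    dcl-definable₂ : (θ : Formula L 3) (g : Op₂ Carrier) →
                     (∀ {y y′ z z′} → y ≈ y′ → z ≈ z′ → g y z ≈ g y′ z′) →
                     (∀ x y z → Sat M (x ∷ᶠ y ∷ᶠ z ∷ᶠ []ᶠ) θ ⇔ x ≈ g y z) →
                     ∀ {y z} → dcl M A y → dcl M A z → dcl M A (g y z)
    dcl-definable₂ θ g g-cong h {y₀} {z₀} (S , (a , ha) , y₀∈S) (T , (b , hb) , z₀∈T) =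
      record
        { formula  = ex (ex (rename f₁ S.formula and rename f₂ T.formula and rename f₃ θ))
        ; params   = S.params ++ T.params
        ; params∈A = VectorAll.++⁺ A S.params∈A T.params∈A }
      , (g y₀ z₀ , λ x → mk⇔
          (λ (y , z , py , pz , pθ) → trans (to (h x y z) (to (Sat-rename (agree₃ x y z) θ) pθ))
            (g-cong (unique ha (to (Sat-rename (agree₁ x y z) S.formula) py) y₀∈S)
                    (unique hb (to (Sat-rename (agree₂ x y z) T.formula) pz) z₀∈T)))
          (satisfied x))
      , satisfied _ refl
      where
      module S = DefinableSet S
      module T = DefinableSet T
      m = S.arityₚ
      n = T.arityₚ

      f₁ : Fin (nsuc m) → Fin (3 + (m + n))
      f₁ zero    = suc zero
      f₁ (suc i) = suc (suc (suc (i ↑ˡ n)))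

      f₂ : Fin (nsuc n) → Fin (3 + (m + n))
      f₂ zero    = zero
      f₂ (suc i) = suc (suc (suc (m ↑ʳ i)))

      f₃ : Fin 3 → Fin (3 + (m + n))
      f₃ zero             = suc (suc zero)
      f₃ (suc zero)       = suc zero
      f₃ (suc (suc zero)) = zero

      env : Carrier → Carrier → Carrier → Vector Carrier (3 + (m + n))
      env x y z = z ∷ᶠ y ∷ᶠ x ∷ᶠ (S.params ++ T.params)

      agree₁ : ∀ x y z → env x y z agrees-with (y ∷ᶠ S.params) along f₁
      agree₁ x y z zero    = refl
      agree₁ x y z (suc i) = reflexive (lookup-++ˡ S.params T.params i)

      agree₂ : ∀ x y z → env x y z agrees-with (z ∷ᶠ T.params) along f₂
      agree₂ x y z zero    = refl
      agree₂ x y z (suc i) = reflexive (lookup-++ʳ S.params T.params i)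

      agree₃ : ∀ x y z → env x y z agrees-with (x ∷ᶠ y ∷ᶠ z ∷ᶠ []ᶠ) along f₃
      agree₃ x y z zero             = refl
      agree₃ x y z (suc zero)       = refl
      agree₃ x y z (suc (suc zero)) = refl

      unique : ∀ {q} {P : Pred Carrier q} {a x y} → (∀ x → P x ⇔ x ≈ a) → P x → P y → x ≈ y
      unique h px py = trans (to (h _) px) (sym (to (h _) py))

      satisfied : ∀ x → x ≈ g y₀ z₀ → Sat M (x ∷ᶠ (S.params ++ T.params))
        (ex (ex (rename f₁ S.formula and rename f₂ T.formula and rename f₃ θ)))
      satisfied x x≈ = y₀ , z₀ ,
        from (Sat-rename (agree₁ x y₀ z₀) S.formula) y₀∈S ,
        from (Sat-rename (agree₂ x y₀ z₀) T.formula) z₀∈T ,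
        from (Sat-rename (agree₃ x y₀ z₀) θ) (from (h x y₀ z₀) x≈)

-- Preservation of formulas by back-and-forth.

module BackAndForth {L : Signature} {c ℓ : Level} (M : Structure L c ℓ)
  {r : Level} (_∼ᵣ_ : ∀ {n} → Rel (Vector (Structure.Carrier M) n) r)
  (∼ᵣ-sym : ∀ {n} {ρ ρ′ : Vector (Structure.Carrier M) n} → ρ ∼ᵣ ρ′ → ρ′ ∼ᵣ ρ)
  (atomic : ∀ {n} {ρ ρ′ : Vector (Structure.Carrier M) n} → ρ ∼ᵣ ρ′ → ∀ s t →
            Structure._≈_ M (eval M ρ s) (eval M ρ t) → Structure._≈_ M (eval M ρ′ s) (eval M ρ′ t))
  (forth : ∀ {n} {ρ ρ′ : Vector (Structure.Carrier M) n} → ρ ∼ᵣ ρ′ →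
           ∀ x → ∃ λ x′ → (x ∷ᶠ ρ) ∼ᵣ (x′ ∷ᶠ ρ′)) where
  open Structure M

  -- Symmetry of the relation supplies the back condition: the premise of an implication and the
  -- instance of a universal quantifier are handled by the reversed relation.
  Sat-transfer : ∀ {n} {ρ ρ′ : Vector Carrier n} → ρ ∼ᵣ ρ′ → ∀ φ → Sat M ρ φ → Sat M ρ′ φ
  Sat-transfer r (s ≗ t) (lift e)      = lift (atomic r s t e)
  Sat-transfer r (φ and ψ) (pφ , pψ)   = Sat-transfer r φ pφ , Sat-transfer r ψ pψ
  Sat-transfer r (φ or ψ) (inj₁ pφ)    = inj₁ (Sat-transfer r φ pφ)
  Sat-transfer r (φ or ψ) (inj₂ pψ)    = inj₂ (Sat-transfer r ψ pψ)
  Sat-transfer r (φ imp ψ) p pφ        = Sat-transfer r ψ (p (Sat-transfer (∼ᵣ-sym r) φ pφ))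
  Sat-transfer r (all φ) p x′          =
    let x , r′ = forth (∼ᵣ-sym r) x′ in Sat-transfer (∼ᵣ-sym r′) φ (p x)
  Sat-transfer r (ex φ) (x , pφ)       =
    let x′ , r′ = forth r x in x′ , Sat-transfer r′ φ pφ

-- Algebraic closure in a model of ECBDA.

module _ {c ℓ : Level} (D : BooleDeMorganAlgebra c ℓ) (model : IsModelECBDA D)
         (_≟_ : Decidable (BooleDeMorganAlgebra._≈_ D)) where
  open Algebra D
  open ExistentiallyClosed D model _≟_

  -- The argument asks of the operations only that they respect `≈` and preserve `Corresponding`, so
  -- one proof covers the languages with and without the Boolean complement.
  module Reduct {L : Signature}
    (op : (f : Signature.Op L) → Vector Carrier (Signature.arity L f) → Carrier)
    (op-cong : (f : Signature.Op L) {u v : Vector Carrier (Signature.arity L f)} →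
               (∀ i → u i ≈ v i) → op f u ≈ op f v)
    (op-corr : ∀ {n} {ρ ρ′ : Vector Carrier n} (f : Signature.Op L)
               {u v : Vector Carrier (Signature.arity L f)} →
               (∀ i → Corresponding ρ ρ′ (u i) (v i)) → Corresponding ρ ρ′ (op f u) (op f v))
    where

    M : Structure L c ℓ
    M = record { isEquivalence = isEquivalence ; interp = op ; interp-cong = op-cong }

    eval-corr : ∀ {n} {ρ ρ′ : Vector Carrier n} t → Corresponding ρ ρ′ (eval M ρ t) (eval M ρ′ t)
    eval-corr (var i)    = corr-var i
    eval-corr (app f ts) = op-corr f (λ i → eval-corr (ts i))

    open BackAndForth M _∼ᵐ_ ∼ᵐ-sym (λ r s t → corr-≈ r (eval-corr s) (eval-corr t)) forth

    acl⊆Generated : ∀ {p} {A : Pred Carrier p} → acl M A ⊆ Generated D A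
    acl⊆Generated {x = x} (S , (xs , finite) , x∈S) = generated-by-minterms params params∈A x unsplit
      where
      open DefinableSet S
      unsplit : ∀ ε → minterm params ε ∧ x ≈ ⊥ ⊎ minterm params ε ∧ ¬ x ≈ ⊥
      unsplit ε with (minterm params ε ∧ x) ≟ ⊥ | (minterm params ε ∧ ¬ x) ≟ ⊥
      ... | yes z | _     = inj₁ z
      ... | no  _ | yes z = inj₂ z
      -- A split minterm yields an `x′` outside `xs` that satisfies the defining formula along with
      -- `x`, although `xs` lists all its solutions.
      ... | no nz | no nz′ =
        let x′ , x∼x′ , x′∉xs = avoid params x ε nz nz′ xs
        in contradiction (to (finite x′) (Sat-transfer x∼x′ formula x∈S)) x′∉xs

  BDM-acl⊆Generated : ∀ {p} {A : Pred Carrier p} → acl (BDMStructure D) A ⊆ Generated D A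
  BDM-acl⊆Generated = Reduct.acl⊆Generated interp interp-cong λ
    { join h → corr-join (h zero) (h (suc zero))
    ; meet h → corr-meet (h zero) (h (suc zero))
    ; comp h → corr-comp (h zero)
    ; bar  h → corr-bar (h zero)
    ; top  h → corr-top
    ; bot  h → corr-bot }
    where open Structure (BDMStructure D)

-- Definability of generated elements in the Boole-De Morgan language.

module _ {c ℓ p : Level} (D : BooleDeMorganAlgebra c ℓ)
         {A : Pred (BooleDeMorganAlgebra.Carrier D) p} where
  open BooleDeMorganAlgebra D
  open Definability (BDMStructure D)

  Generated⊆BDM-dcl : Generated D A ⊆ dcl (BDMStructure D) A
  Generated⊆BDM-dcl (gen a)    = ⊆dcl a
  Generated⊆BDM-dcl (join g h) = dcl-definable₂
    (var zero ≗ app join (var (suc zero) ∷ᶠ var (suc (suc zero)) ∷ᶠ []ᶠ)) _∨_ ∨-cong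
    (λ x y z → mk⇔ lower lift) (Generated⊆BDM-dcl g) (Generated⊆BDM-dcl h)
  Generated⊆BDM-dcl (meet g h) = dcl-definable₂
    (var zero ≗ app meet (var (suc zero) ∷ᶠ var (suc (suc zero)) ∷ᶠ []ᶠ)) _∧_ ∧-cong
    (λ x y z → mk⇔ lower lift) (Generated⊆BDM-dcl g) (Generated⊆BDM-dcl h)
  -- A unary operation is passed as a binary one depending on its first argument, and the same
  -- closure proof is supplied twice.
  Generated⊆BDM-dcl (comp g)   = dcl-definable₂
    (var zero ≗ app comp (var (suc zero) ∷ᶠ []ᶠ)) (λ y _ → ¬ y) (λ e _ → ¬-cong e)
    (λ x y z → mk⇔ lower lift) (Generated⊆BDM-dcl g) (Generated⊆BDM-dcl g)
  Generated⊆BDM-dcl (bar g)    = dcl-definable₂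
    (var zero ≗ app bar (var (suc zero) ∷ᶠ []ᶠ)) (λ y _ → ∼ y) (λ e _ → ∼-cong e)
    (λ x y z → mk⇔ lower lift) (Generated⊆BDM-dcl g) (Generated⊆BDM-dcl g)
  Generated⊆BDM-dcl top        =
    dcl-definable₀ (var zero ≗ app top []ᶠ) ⊤ (λ x → mk⇔ lower lift)
  Generated⊆BDM-dcl bot        =
    dcl-definable₀ (var zero ≗ app bot []ᶠ) ⊥ (λ x → mk⇔ lower lift)
  Generated⊆BDM-dcl (resp e g) = dcl-resp e (Generated⊆BDM-dcl g)

-- Models of ECDA as models of ECBDA.

module _ {c ℓ : Level} (D : ComplementedDeMorganAlgebra c ℓ) where
  private B = asBooleDeMorgan D
  open Algebra B

  ¬-unique : ∀ {x z} → x ∨ z ≈ ⊤ → x ∧ z ≈ ⊥ → z ≈ ¬ x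
  ¬-unique {x} x∨z≈⊤ x∧z≈⊥ =
    complement-unique D x∧z≈⊥ x∨z≈⊤ (proj₂ ∧-complement x) (proj₂ ∨-complement x)

  VanishesExactlyOn-cong : ∀ {n} {I : Subset n} {y t u} → t ≈ u →
    VanishesExactlyOn isDeMorganAlgebra I y t → VanishesExactlyOn isDeMorganAlgebra I y u
  VanishesExactlyOn-cong t≈u (on , off) =
    (λ i i∈I → trans (∧-cong refl (sym t≈u)) (on i i∈I)) ,
    (λ i i∉I z → off i i∉I (trans (∧-cong refl t≈u) z))

  -- By uniqueness of complements, the witnesses `z` and `w` of the ECDA formulas are `x *` and
  -- `¬ x`, while `y i * ≈ y (σ i)` says that `y (σ i)` is a complement of `∼ (y i)`.
  ECDA⇒ECBDA : IsModelECDA D → IsModelECBDA B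
  ECDA⇒ECBDA model n 1≤n σ σ² I₁ I₂ I₃ con y y≉⊥ ⋁y≈⊤ disjoint y*≈ =
    let x , ψ , (z , ξ₁ , ξ₀ , ξ) , (w , χ₁ , χ₀ , χ) =
          model n 1≤n σ σ² I₁ I₂ I₃ con y y≉⊥ ⋁y≈⊤ disjoint λ i →
            trans (∨-cong refl (sym (y*≈ i))) (proj₂ ∨-complement _) ,
            trans (∧-cong refl (sym (y*≈ i))) (proj₂ ∧-complement _)
    in x , ψ , VanishesExactlyOn-cong (∧-cong refl (¬-unique ξ₁ ξ₀)) ξ
             , VanishesExactlyOn-cong (∧-cong (¬-unique χ₁ χ₀) refl) χ

  DM-acl⊆Generated : IsModelECDA D → Decidable _≈_ →
                     ∀ {p} {A : Pred Carrier p} → acl (DMStructure D) A ⊆ Generated B A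
  DM-acl⊆Generated model _≟_ = Reduct.acl⊆Generated B (ECDA⇒ECBDA model) _≟_ interp interp-cong λ
    { join h → corr-join (h zero) (h (suc zero))
    ; meet h → corr-meet (h zero) (h (suc zero))
    ; bar  h → corr-bar (h zero)
    ; top  h → corr-top
    ; bot  h → corr-bot }
    where
    open Structure (DMStructure D) using (interp; interp-cong)
    open ExistentiallyClosed B (ECDA⇒ECBDA model) _≟_

  module _ {p : Level} {A : Pred Carrier p} where
    open Definability (DMStructure D)

    Generated⊆DM-dcl : Generated B A ⊆ dcl (DMStructure D) A
    Generated⊆DM-dcl (gen a)    = ⊆dcl a
    Generated⊆DM-dcl (join g h) = dcl-definable₂
      (var zero ≗ app join (var (suc zero) ∷ᶠ var (suc (suc zero)) ∷ᶠ []ᶠ)) _∨_ ∨-cong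
      (λ x y z → mk⇔ lower lift) (Generated⊆DM-dcl g) (Generated⊆DM-dcl h)
    Generated⊆DM-dcl (meet g h) = dcl-definable₂
      (var zero ≗ app meet (var (suc zero) ∷ᶠ var (suc (suc zero)) ∷ᶠ []ᶠ)) _∧_ ∧-cong
      (λ x y z → mk⇔ lower lift) (Generated⊆DM-dcl g) (Generated⊆DM-dcl h)
    -- The language has no symbol for the complement, so its two lattice equations serve as the
    -- defining formula.
    Generated⊆DM-dcl (comp g)   = dcl-definable₂
      (app join (var (suc zero) ∷ᶠ var zero ∷ᶠ []ᶠ) ≗ app top []ᶠ and
       app meet (var (suc zero) ∷ᶠ var zero ∷ᶠ []ᶠ) ≗ app bot []ᶠ) (λ y _ → ¬ y) (λ e _ → ¬-cong e)
      (λ x y z → mk⇔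
        (λ (lift y∨x≈⊤ , lift y∧x≈⊥) → ¬-unique y∨x≈⊤ y∧x≈⊥)
        (λ x≈ → lift (trans (∨-cong refl x≈) (proj₂ ∨-complement y)) ,
                lift (trans (∧-cong refl x≈) (proj₂ ∧-complement y))))
      (Generated⊆DM-dcl g) (Generated⊆DM-dcl g)
    Generated⊆DM-dcl (bar g)    = dcl-definable₂
      (var zero ≗ app bar (var (suc zero) ∷ᶠ []ᶠ)) (λ y _ → ∼ y) (λ e _ → ∼-cong e)
      (λ x y z → mk⇔ lower lift) (Generated⊆DM-dcl g) (Generated⊆DM-dcl g)
    Generated⊆DM-dcl top        =
      dcl-definable₀ (var zero ≗ app top []ᶠ) ⊤ (λ x → mk⇔ lower lift)
    Generated⊆DM-dcl bot        =
      dcl-definable₀ (var zero ≗ app bot []ᶠ) ⊥ (λ x → mk⇔ lower lift)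
    Generated⊆DM-dcl (resp e g) = dcl-resp e (Generated⊆DM-dcl g)

theorem6p7 : {c ℓ p : Level} → ExcludedMiddle (c ⊔ ℓ ⊔ p) →
    ((D : BooleDeMorganAlgebra c ℓ) → IsModelECBDA D →
    (A : Pred (BooleDeMorganAlgebra.Carrier D) p) →
    dcl (BDMStructure D) A ≐ Generated D A ×
    acl (BDMStructure D) A ≐ Generated D A)
    ×
    ((D : ComplementedDeMorganAlgebra c ℓ) → IsModelECDA D →
    (A : Pred (ComplementedDeMorganAlgebra.Carrier D) p) →
    dcl (DMStructure D) A ≐ Generated (asBooleDeMorgan D) A ×
    acl (DMStructure D) A ≐ Generated (asBooleDeMorgan D) A)
theorem6p7 {c} {ℓ} {p} em =
  (λ D model A →
    sandwich (Definability.dcl⊆acl (BDMStructure D)) (Generated⊆BDM-dcl D)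
             (BDM-acl⊆Generated D model (λ _ _ → em₀))) ,
  (λ D model A →
    sandwich (Definability.dcl⊆acl (DMStructure D)) (Generated⊆DM-dcl D)
             (DM-acl⊆Generated D model (λ _ _ → em₀)))
  where
  -- Excluded middle enters only as decidability of `≈`, which lives at level `ℓ`.
  em₀ : ExcludedMiddle ℓ
  em₀ {P} = map′ lower lift (em {Lift (c ⊔ p) P})

  -- The inclusions close a cycle from `dcl` through `acl` and the generated subalgebra back to
  -- `dcl`.
  sandwich : ∀ {a q r s} {X : Set a} {P : Pred X q} {Q : Pred X r} {G : Pred X s} →
             P ⊆ Q → G ⊆ P → Q ⊆ G → P ≐ G × Q ≐ G
  sandwich P⊆Q G⊆P Q⊆G = (Q⊆G ∘ P⊆Q , G⊆P) , (Q⊆G , P⊆Q ∘ G⊆P)
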